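{- Let $\mathcal{A}$ be a set composed of $m$ non-zero vectors in $\mathbb{Q}^n$. Then there exists a randomized algorithm with expected arithmetic complexity $O(n \cdot m)$ which finds a vector $z \in \mathbb{Z}^n$ such that: (1) $a^\top z \neq 0$ for every $a \in \mathcal{A}$; (2) $\|z\|_{\infty} \leq m$.
   Context: Arithmetic complexity is the number of elementary arithmetic operations, performed on numbers whose bit-size is bounded by a polynomial in the input size. -}

module Defs where

open import Data.Bool.Base using (Bool; if_then_else_)
open import Data.Fin.Base using (Fin; toℕ; fromℕ<)
open import Data.Integer.Base as ℤ using (ℤ; +_)
open import Data.List.Base using (List; []; _∷_; _++_)
open import Data.Nat.Base as ℕ using (ℕ; zero; suc)
open import Data.Nat.Logarithm using (⌈log₂_⌉)
import Data.Nat.Properties as ℕ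
open import Data.Product.Base using (_×_; _,_)
open import Data.Rational.Base as ℚ using (ℚ; 0ℚ; 1ℚ; ↥_; ↧ₙ_)
import Data.Rational.Properties as ℚ
open import Data.Vec.Base as Vec using (Vec; lookup; replicate)
open import Algebra.Definitions.RawMonoid ℚ.+-0-rawMonoid using (sum)
open import Relation.Binary.Construct.Closure.ReflexiveTransitive using (Star)
open import Relation.Binary.PropositionalEquality using (_≡_; _≢_)
open import Relation.Nullary using (does; yes; no)

fromℤ : ℤ → ℚ
fromℤ k = k ℚ./ 1

fromℕ : ℕ → ℚ
fromℕ k = fromℤ (+ k)

infix 8 _ᵀ_

_ᵀ_ : ∀ {n} → Vec ℚ n → Vec ℤ n → ℚ
a ᵀ z = Vec.foldr _ ℚ._+_ 0ℚ (Vec.zipWith (λ x k → x ℚ.* fromℤ k) a z)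

‖_‖∞ : ∀ {n} → Vec ℤ n → ℕ
‖ z ‖∞ = Vec.foldr _ ℕ._⊔_ 0 (Vec.map ℤ.∣_∣ z)

NonZeroVec : ∀ {n} → Vec ℚ n → Set
NonZeroVec {n} a = a ≢ replicate n 0ℚ

-- Bit-sizes: one sign bit, plus ⌈log₂ (k + 1)⌉ binary digits for each
-- natural number k written down.  Rationals are in lowest terms.

sizeℕ : ℕ → ℕ
sizeℕ k = 1 ℕ.+ ⌈log₂ suc k ⌉

sizeℚ : ℚ → ℕ
sizeℚ q = 1 ℕ.+ ⌈log₂ suc ℤ.∣ ↥ q ∣ ⌉ ℕ.+ ⌈log₂ suc (↧ₙ q) ⌉

inputSize : ∀ {n m} → Vec (Vec ℚ n) m → ℕ
inputSize {n} {m} A =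
  sizeℕ n ℕ.+ sizeℕ m ℕ.+ Vec.sum (Vec.map (λ a → Vec.sum (Vec.map sizeℚ a)) A)

-- Randomized algorithms: programs for a random access machine.  A program
-- is a finite piece of syntax that does not depend on n, m or the input.
-- The machine has index registers holding naturals and a data memory of
-- rationals, addressed indirectly through the index registers.

Reg : Set
Reg = ℕ

data IndexOp : Set where
  add sub mul : IndexOp

data DataOp : Set where
  add sub mul div : DataOp

-- Below, I r is the content of index register r and D[k] that of data
-- cell k.
data Test : Set where
  index<  : (r s : Reg) → Test                      -- I r < I s
  data<   : (r s : Reg) → Test                      -- D[I r] < D[I s]
  data≡   : (r s : Reg) → Test                      -- D[I r] ≡ D[I s]

data Command : Set where
  iconst  : (r : Reg) (k : ℕ) → Command             -- I r := k
  iop     : IndexOp → (r s t : Reg) → Command       -- I r := I s ∙ I t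
  uniform : (r s : Reg) → Command                   -- I r := random in {0,…,I s}
  dconst  : (r : Reg) (q : ℚ) → Command             -- D[I r] := q
  dop     : DataOp → (r s t : Reg) → Command        -- D[I r] := D[I s] ∙ D[I t]
  cast    : (r s : Reg) → Command                   -- D[I r] := I s
  input   : (r s t : Reg) → Command                 -- D[I r] := A[I s][I t]
  if      : Test → (P Q : List Command) → Command
  while   : Test → (P : List Command) → Command

Program : Set
Program = List Command

record State : Set where
  constructor ⟨_,_⟩
  field
    I : ℕ → ℕ
    D : ℕ → ℚ

open State public

infixl 6 _[_≔_]

_[_≔_] : {X : Set} → (ℕ → X) → ℕ → X → (ℕ → X)
(f [ k ≔ x ]) l = if does (k ℕ.≟ l) then x else f l

setI : Reg → ℕ → State → State
setI r k s = ⟨ I s [ r ≔ k ] , D s ⟩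

setD : Reg → ℚ → State → State
setD r q s = ⟨ I s , D s [ I s r ≔ q ] ⟩

⟦_⟧ᵢ : IndexOp → ℕ → ℕ → ℕ
⟦ add ⟧ᵢ = ℕ._+_
⟦ sub ⟧ᵢ = ℕ._∸_
⟦ mul ⟧ᵢ = ℕ._*_

-- Division by zero yields zero.
⟦_⟧ₐ : DataOp → ℚ → ℚ → ℚ
⟦ add ⟧ₐ p q = p ℚ.+ q
⟦ sub ⟧ₐ p q = p ℚ.- q
⟦ mul ⟧ₐ p q = p ℚ.* q
⟦ div ⟧ₐ p q with q ℚ.≟ 0ℚ
... | yes _   = 0ℚ
... | no  q≢0 = (p ℚ.÷ q) {{ℚ.≢-nonZero q≢0}}

holds : Test → State → Bool
holds (index< r t) s = does (I s r ℕ.<? I s t)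
holds (data<  r t) s = does (D s (I s r) ℚ.<? D s (I s t))
holds (data≡  r t) s = does (D s (I s r) ℚ.≟ D s (I s t))

-- Entries outside the range of the input read as zero.
entry : ∀ {n m} → Vec (Vec ℚ n) m → ℕ → ℕ → ℚ
entry {n} {m} A i j with i ℕ.<? m | j ℕ.<? n
... | yes i<m | yes j<n = lookup (lookup A (fromℕ< i<m)) (fromℕ< j<n)
... | _       | _       = 0ℚ

-- The commands still to be executed, and the current state.
Config : Set
Config = Program × State

-- next k f: move to one of f 0 , … , f k , each with probability 1/(k+1),
-- independently of all earlier moves.
data Move : Set where
  halt : Move
  next : (k : ℕ) → (Fin (suc k) → Config) → Move

continue : Config → Move
continue c = next 0 (λ _ → c)

-- Every command, and every evaluation of a test, is one step.
step : ∀ {n m} → Vec (Vec ℚ n) m → Config → Move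
step A ([]                , s) = halt
step A (iconst r k    ∷ K , s) = continue (K , setI r k s)
step A (iop ∙ r t u   ∷ K , s) = continue (K , setI r (⟦ ∙ ⟧ᵢ (I s t) (I s u)) s)
step A (uniform r t   ∷ K , s) = next (I s t) (λ i → K , setI r (toℕ i) s)
step A (dconst r q    ∷ K , s) = continue (K , setD r q s)
step A (dop ∙ r t u   ∷ K , s) =
  continue (K , setD r (⟦ ∙ ⟧ₐ (D s (I s t)) (D s (I s u))) s)
step A (cast r t      ∷ K , s) = continue (K , setD r (fromℕ (I s t)) s)
step A (input r t u   ∷ K , s) = continue (K , setD r (entry A (I s t) (I s u)) s)
step A (if b P Q      ∷ K , s) =
  continue ((if holds b s then P else Q) ++ K , s)
step A (while b P     ∷ K , s) =
  continue ((if holds b s then P ++ while b P ∷ K else K) , s)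

initial : ∀ {n m} → Program → Vec (Vec ℚ n) m → Config
initial {n} {m} P A = P , ⟨ (λ _ → 0) [ 0 ≔ n ] [ 1 ≔ m ] , (λ _ → 0ℚ) ⟩

data Successor {n m} (A : Vec (Vec ℚ n) m) (c : Config) : Config → Set where
  via : ∀ {k f} → step A c ≡ next k f → (i : Fin (suc k)) → Successor A c (f i)

-- Configurations occurring with positive probability.
Reachable : ∀ {n m} → Program → Vec (Vec ℚ n) m → Config → Set
Reachable P A = Star (Successor A) (initial P A)

HaltsIn : ∀ {n m} → Program → Vec (Vec ℚ n) m → State → Set
HaltsIn P A s = Reachable P A ([] , s)

-- The output is read off the first n data cells.
Outputs : ∀ {n} → State → Vec ℤ n → Set
Outputs {n} s z = ∀ (i : Fin n) → D s (toℕ i) ≡ fromℤ (lookup z i)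

-- With T the (possibly infinite) number of steps made from a
-- configuration, this is the expectation of min(T , t).
expectedSteps : ∀ {n m} → Vec (Vec ℚ n) m → (t : ℕ) → Config → ℚ
expectedSteps A zero    c = 0ℚ
expectedSteps A (suc t) c with step A c
... | halt     = 0ℚ
... | next k f =
  1ℚ ℚ.+ (+ 1 ℚ./ suc k) ℚ.* sum (λ i → expectedSteps A t (f i))

-- By monotone convergence, this says that the expectation of the number
-- of steps is at most B.  In particular the program halts almost surely.
ExpectedSteps≤ : ∀ {n m} → Program → Vec (Vec ℚ n) m → ℕ → Set
ExpectedSteps≤ P A B = ∀ t → expectedSteps A t (initial P A) ℚ.≤ fromℕ B

-- In every run, all numbers ever held by the machine have at most b bits.
BitSizes≤ : ∀ {n m} → Program → Vec (Vec ℚ n) m → ℕ → Set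
BitSizes≤ P A b = ∀ {K s} → Reachable P A (K , s) →
  ∀ k → sizeℕ (I s k) ℕ.≤ b × sizeℚ (D s k) ℕ.≤ b

{-# OPTIONS --safe #-}
module Submission where

-- The coordinates of z are chosen one after the other, keeping for every row
-- a_i the partial sum p_i = Σ_{l<j} a_il z_l, with the invariant that p_i ≠ 0
-- unless a_il = 0 for all l < j.  A value w of z_j violates the invariant for
-- row i only if a_ij ≠ 0 and p_i + a_ij w = 0, that is, for at most one w.  So
-- at most m of the 2m+1 integers in [-m, m] are bad, a uniformly random one is
-- good with probability above 1/2, and an attempt costs O(m): the expected
-- cost is O(m) per coordinate.

-- Computing `a ᵀ z` afresh in every attempt would cost `O(n)` per row, so the partial sums are kept
-- in memory and updated in place. A rejected value has then already entered them; instead of being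
-- undone it is corrected by the next attempt, which adds `a_ij` times the difference between the
-- new and the old value. For this reason a scan does not stop at the first bad row.
--
-- The retry loop has no bound on its number of iterations. Its expected cost is therefore certified
-- by attaching to each configuration a bound `x` such that one step plus the average of the bounds
-- at the outcomes is at most `x`. Such a certificate, cut off after `t` steps, is built by
-- induction on `t`; it carries safety and correctness of the output along the same runs.
--
-- Since runs may be arbitrarily long, the bit-size bound must not depend on the number of attempts.
-- It does not, because each stored sum equals a partial sum for coordinates of absolute value at
-- most `m`, whose height is bounded from the sizes of the entries in its row.

open import Defs
open import Algebra.Bundles using (AbelianGroup)
open import Algebra.Core using (Op₂)
open import Algebra.Structures using (IsMonoid)
import Algebra.Properties.Group as Group
open import Data.Bool.Base using (true; false; if_then_else_)
open import Data.Fin.Base using (Fin; toℕ; fromℕ<; zero; suc)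
import Data.Fin.Properties as Fin
open import Data.Integer.Base as ℤ using (ℤ; +_)
import Data.Integer.GCD as ℤ
import Data.Integer.Properties as ℤ
open import Data.Integer.Tactic.RingSolver using () renaming (solve-∀ to solveℤ-∀)
open import Data.List.Base using ([]; _∷_; _++_)
open import Data.Nat.Base as ℕ using (ℕ; zero; suc; _≤_; _<_; _+_; _*_; _^_; _⊔_; z≤n; s≤s)
open import Data.Nat.Coprimality as Coprime using (1-coprimeTo)
import Data.Nat.GCD as ℕ
open import Data.Nat.Induction using (<-rec)
open import Data.Nat.Logarithm using (⌈log₂_⌉; ⌈log₂⌉-mono-≤; ⌈log₂⌈n/2⌉⌉≡⌈log₂n⌉∸1; ⌈log₂2^n⌉≡n)
import Data.Nat.Properties as ℕ
open import Data.Nat.Tactic.RingSolver using (solve-∀)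
open import Data.Product.Base using (Σ-syntax; ∃-syntax; _×_; _,_; proj₁; proj₂)
open import Data.Rational.Base as ℚ using (ℚ; 0ℚ; 1ℚ; mkℚ; ↥_; ↧_; ↧ₙ_)
import Data.Rational.Properties as ℚ
open import Data.Sum.Base using (_⊎_; inj₁; inj₂)
open import Data.Unit.Base using (⊤; tt)
open import Data.Vec.Base as Vec using (Vec; []; _∷_; lookup; replicate)
open import Data.Vec.Membership.Propositional using (_∈_)
import Data.Vec.Properties as Vec
import Data.Vec.Relation.Unary.Any as Any
import Data.Vec.Relation.Unary.Any.Properties as Any
open import Data.Vec.Relation.Unary.Unique.Propositional using (Unique)
open import Function.Base using (_∘_; _$_)
open import Relation.Binary.Construct.Closure.ReflexiveTransitive using (Star; ε; _◅_)
open import Relation.Binary.PropositionalEquality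
open import Relation.Nullary using (Dec; does; yes; no; ¬_; contradiction)
open import Relation.Nullary.Decidable using (_×-dec_; ¬?; dec-true; dec-false)

open import Algebra.Definitions.RawMonoid ℚ.+-0-rawMonoid using () renaming (sum to sumℚ)
open import Algebra.Properties.CommutativeMonoid.Sum ℕ.+-0-commutativeMonoid using (sum; ∑-distrib-+)

-- Heights and bit-sizes

-- `ℚ./` normalises by a gcd and is stuck on a variable; the explicit fraction lets rational
-- arithmetic on integers compute.
fromℤ≡mkℚ : ∀ k → fromℤ k ≡ mkℚ k 0 (Coprime.sym (1-coprimeTo ℤ.∣ k ∣))
fromℤ≡mkℚ k = ℚ.↥p/↧p≡p (mkℚ k 0 (Coprime.sym (1-coprimeTo ℤ.∣ k ∣)))

fromℤ-+ : ∀ i j → fromℤ (i ℤ.+ j) ≡ fromℤ i ℚ.+ fromℤ j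
fromℤ-+ i j rewrite fromℤ≡mkℚ i | fromℤ≡mkℚ j =
  cong fromℤ (sym (cong₂ ℤ._+_ (ℤ.*-identityʳ i) (ℤ.*-identityʳ j)))

fromℤ-* : ∀ i j → fromℤ (i ℤ.* j) ≡ fromℤ i ℚ.* fromℤ j
fromℤ-* i j rewrite fromℤ≡mkℚ i | fromℤ≡mkℚ j = refl

fromℤ-neg : ∀ i → fromℤ (ℤ.- i) ≡ ℚ.- fromℤ i
fromℤ-neg i = trans (fromℤ≡mkℚ (ℤ.- i)) (sym (trans (cong ℚ.-_ (fromℤ≡mkℚ i)) (neg i)))
  where
  neg : ∀ i → ℚ.- mkℚ i 0 (Coprime.sym (1-coprimeTo ℤ.∣ i ∣)) ≡
              mkℚ (ℤ.- i) 0 (Coprime.sym (1-coprimeTo ℤ.∣ ℤ.- i ∣))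
  neg (+ 0)          = refl
  neg (+ suc _)      = refl
  neg (ℤ.-[1+ _ ])   = refl

fromℤ-- : ∀ i j → fromℤ (i ℤ.- j) ≡ fromℤ i ℚ.- fromℤ j
fromℤ-- i j = trans (fromℤ-+ i (ℤ.- j)) (cong (fromℤ i ℚ.+_) (fromℤ-neg j))

fromℤ-injective : ∀ {i j} → fromℤ i ≡ fromℤ j → i ≡ j
fromℤ-injective {i} {j} eq =
  cong ↥_ (trans (sym (fromℤ≡mkℚ i)) (trans eq (fromℤ≡mkℚ j)))

fromℕ-mono-≤ : ∀ {i j} → i ≤ j → fromℕ i ℚ.≤ fromℕ j
fromℕ-mono-≤ {i} {j} i≤j rewrite fromℤ≡mkℚ (+ i) | fromℤ≡mkℚ (+ j) =
  ℚ.*≤* (subst₂ ℤ._≤_ (sym (ℤ.*-identityʳ (+ i))) (sym (ℤ.*-identityʳ (+ j))) (ℤ.+≤+ i≤j))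

1/k*k≡1 : ∀ k → (+ 1 ℚ./ suc k) ℚ.* fromℕ (suc k) ≡ 1ℚ
1/k*k≡1 k = begin
  (+ 1 ℚ./ suc k) ℚ.* fromℕ (suc k)
    ≡⟨ cong₂ ℚ._*_ (ℚ.↥p/↧p≡p (mkℚ (+ 1) k (1-coprimeTo (suc k)))) (fromℤ≡mkℚ (+ suc k)) ⟩
  mkℚ (+ 1) k (1-coprimeTo (suc k)) ℚ.* mkℚ (+ suc k) 0 (Coprime.sym (1-coprimeTo (suc k)))
    ≡⟨ ℚ.*-inverseˡ (mkℚ (+ suc k) 0 (Coprime.sym (1-coprimeTo (suc k)))) ⟩
  1ℚ ∎
  where open ≡-Reasoning

-- Unlike the numerator, this is submultiplicative for addition as well as for
-- multiplication, so that bit-sizes of sums of products add up.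
height : ℚ → ℕ
height q = ℤ.∣ ↥ q ∣ + ↧ₙ q

-- Reduction to lowest terms divides both parts by their gcd, which is nonzero because `d` is.
height-/ : ∀ i d .{{_ : ℕ.NonZero d}} → height (i ℚ./ d) ≤ ℤ.∣ i ∣ + d
height-/ i d = ℕ.+-mono-≤ (divides (↥ (i ℚ./ d)) i (ℚ.↥-/ i d)) (divides (↧ (i ℚ./ d)) (+ d) (ℚ.↧-/ i d))
  where
  g = ℕ.gcd ℤ.∣ i ∣ d
  instance
    g≢0 : ℕ.NonZero g
    g≢0 = ℕ.≢-nonZero (ℕ.gcd[m,n]≢0 ℤ.∣ i ∣ d (inj₂ (ℕ.≢-nonZero⁻¹ d)))
  divides : ∀ j k → j ℤ.* ℤ.gcd i (+ d) ≡ k → ℤ.∣ j ∣ ≤ ℤ.∣ k ∣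
  divides j k eq = ℕ.≤-trans (ℕ.m≤m*n ℤ.∣ j ∣ g)
    (ℕ.≤-reflexive (trans (sym (ℤ.abs-* j (ℤ.gcd i (+ d)))) (cong ℤ.∣_∣ eq)))

-- The product of the heights expands into four terms, three of which bound the unreduced numerator
-- and denominator of the sum.
height-+ : ∀ p q → height (p ℚ.+ q) ≤ height p * height q
height-+ p@record{} q@record{} = begin
  height (p ℚ.+ q)                                        ≤⟨ height-/ (a ℤ.* d ℤ.+ c ℤ.* b) (↧ₙ p * ↧ₙ q) ⟩
  ℤ.∣ a ℤ.* d ℤ.+ c ℤ.* b ∣ + ↧ₙ p * ↧ₙ q                 ≤⟨ ℕ.+-monoˡ-≤ _ (ℤ.∣i+j∣≤∣i∣+∣j∣ (a ℤ.* d) (c ℤ.* b)) ⟩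
  ℤ.∣ a ℤ.* d ∣ + ℤ.∣ c ℤ.* b ∣ + ↧ₙ p * ↧ₙ q
    ≡⟨ cong₂ (λ x y → x + y + ↧ₙ p * ↧ₙ q) (ℤ.abs-* a d) (ℤ.abs-* c b) ⟩
  ℤ.∣ a ∣ * ↧ₙ q + ℤ.∣ c ∣ * ↧ₙ p + ↧ₙ p * ↧ₙ q           ≤⟨ ℕ.m≤m+n _ (ℤ.∣ a ∣ * ℤ.∣ c ∣) ⟩
  ℤ.∣ a ∣ * ↧ₙ q + ℤ.∣ c ∣ * ↧ₙ p + ↧ₙ p * ↧ₙ q + ℤ.∣ a ∣ * ℤ.∣ c ∣
    ≡⟨ expand ℤ.∣ a ∣ (↧ₙ p) ℤ.∣ c ∣ (↧ₙ q) ⟩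
  height p * height q ∎
  where
  open ℕ.≤-Reasoning
  a = ↥ p
  b = ↧ p
  c = ↥ q
  d = ↧ q
  expand : ∀ a b c d → a * d + c * b + b * d + a * c ≡ (a + b) * (c + d)
  expand = solve-∀

height-* : ∀ p q → height (p ℚ.* q) ≤ height p * height q
height-* p@record{} q@record{} = begin
  height (p ℚ.* q)                          ≤⟨ height-/ (↥ p ℤ.* ↥ q) (↧ₙ p * ↧ₙ q) ⟩
  ℤ.∣ ↥ p ℤ.* ↥ q ∣ + ↧ₙ p * ↧ₙ q           ≡⟨ cong (_+ ↧ₙ p * ↧ₙ q) (ℤ.abs-* (↥ p) (↥ q)) ⟩
  ℤ.∣ ↥ p ∣ * ℤ.∣ ↥ q ∣ + ↧ₙ p * ↧ₙ q
    ≤⟨ ℕ.+-mono-≤ (ℕ.*-monoʳ-≤ ℤ.∣ ↥ p ∣ (ℕ.m≤m+n _ (↧ₙ q))) (ℕ.*-monoʳ-≤ (↧ₙ p) (ℕ.m≤n+m _ ℤ.∣ ↥ q ∣)) ⟩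
  ℤ.∣ ↥ p ∣ * height q + ↧ₙ p * height q    ≡⟨ ℕ.*-distribʳ-+ (height q) ℤ.∣ ↥ p ∣ (↧ₙ p) ⟨
  height p * height q ∎
  where open ℕ.≤-Reasoning

height-fromℤ : ∀ k → height (fromℤ k) ≡ suc ℤ.∣ k ∣
height-fromℤ k = trans (cong height (fromℤ≡mkℚ k)) (ℕ.+-comm ℤ.∣ k ∣ 1)

k≤2^⌈log₂k⌉ : ∀ k → k ≤ 2 ^ ⌈log₂ k ⌉
k≤2^⌈log₂k⌉ = <-rec _ bound
  where
  open ℕ.≤-Reasoning
  bound : ∀ k → (∀ {j} → j < k → j ≤ 2 ^ ⌈log₂ j ⌉) → k ≤ 2 ^ ⌈log₂ k ⌉
  bound 0             _  = z≤n
  bound 1             _  = ℕ.m^n>0 2 ⌈log₂ 1 ⌉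
  bound k@(suc (suc j)) ih = begin
    k                                          ≡⟨ ℕ.⌊n/2⌋+⌈n/2⌉≡n k ⟨
    ℕ.⌊ k /2⌋ + ℕ.⌈ k /2⌉                      ≤⟨ ℕ.+-mono-≤ (ℕ.⌊n/2⌋≤⌈n/2⌉ k) (ℕ.m≤m+n _ 0) ⟩
    2 * ℕ.⌈ k /2⌉                              ≤⟨ ℕ.*-monoʳ-≤ 2 (ih (ℕ.⌈n/2⌉<n j)) ⟩
    2 ^ suc ⌈log₂ ℕ.⌈ k /2⌉ ⌉                  ≡⟨ cong (λ e → 2 ^ suc e) (⌈log₂⌈n/2⌉⌉≡⌈log₂n⌉∸1 k) ⟩
    2 ^ suc (⌈log₂ k ⌉ ℕ.∸ 1)                  ≡⟨ cong (2 ^_) (ℕ.m+[n∸m]≡n (⌈log₂⌉-mono-≤ {2} {k} (s≤s (s≤s z≤n)))) ⟩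
    2 ^ ⌈log₂ k ⌉ ∎

⌈log₂⌉≤ : ∀ {k e} → k ≤ 2 ^ e → ⌈log₂ k ⌉ ≤ e
⌈log₂⌉≤ {k} {e} k≤2^e = subst (⌈log₂ k ⌉ ≤_) (⌈log₂2^n⌉≡n e) (⌈log₂⌉-mono-≤ k≤2^e)

sizeℕ≤ : ∀ {k e} → suc k ≤ 2 ^ e → sizeℕ k ≤ suc e
sizeℕ≤ {k} {e} k<2^e = s≤s (⌈log₂⌉≤ {suc k} {e} k<2^e)

-- The sign bit counted by `sizeℕ` supplies the factor 2, which later absorbs the range `2m` of
-- differences of two coordinates.
2*suc≤2^sizeℕ : ∀ k → 2 * suc k ≤ 2 ^ sizeℕ k
2*suc≤2^sizeℕ k = ℕ.*-monoʳ-≤ 2 (k≤2^⌈log₂k⌉ (suc k))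

height≤2^sizeℚ : ∀ q → height q ≤ 2 ^ sizeℚ q
height≤2^sizeℚ q = begin
  a + b                                              ≤⟨ ℕ.m≤m+n (a + b) (suc (a * b)) ⟩
  a + b + suc (a * b)                                ≡⟨ expand a b ⟩
  suc a * suc b                                      ≤⟨ ℕ.*-mono-≤ (k≤2^⌈log₂k⌉ (suc a)) (k≤2^⌈log₂k⌉ (suc b)) ⟩
  2 ^ ⌈log₂ suc a ⌉ * 2 ^ ⌈log₂ suc b ⌉              ≡⟨ ℕ.^-distribˡ-+-* 2 ⌈log₂ suc a ⌉ ⌈log₂ suc b ⌉ ⟨
  2 ^ (⌈log₂ suc a ⌉ + ⌈log₂ suc b ⌉)                ≤⟨ ℕ.^-monoʳ-≤ 2 (ℕ.n≤1+n (⌈log₂ suc a ⌉ + ⌈log₂ suc b ⌉)) ⟩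
  2 ^ sizeℚ q ∎
  where
  open ℕ.≤-Reasoning
  a = ℤ.∣ ↥ q ∣
  b = ↧ₙ q
  expand : ∀ a b → a + b + suc (a * b) ≡ suc a * suc b
  expand = solve-∀

-- The two parts behave differently: the denominator is at least 1, which absorbs the successor of
-- the numerator, but the numerator may be 0, so the successor of the denominator costs one more
-- bit.
sizeℚ≤ : ∀ q e → height q ≤ 2 ^ e → sizeℚ q ≤ 2 + (e + e)
sizeℚ≤ q e h = begin
  1 + ⌈log₂ suc ℤ.∣ ↥ q ∣ ⌉ + ⌈log₂ suc (↧ₙ q) ⌉  ≤⟨ s≤s (ℕ.+-mono-≤ numerator denominator) ⟩
  1 + (e + suc e)                                 ≡⟨ cong suc (ℕ.+-suc e e) ⟩
  2 + (e + e) ∎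
  where
  open ℕ.≤-Reasoning
  numerator : ⌈log₂ suc ℤ.∣ ↥ q ∣ ⌉ ≤ e
  numerator = ⌈log₂⌉≤ {suc ℤ.∣ ↥ q ∣} (ℕ.≤-trans
    (subst (_≤ height q) (ℕ.+-comm ℤ.∣ ↥ q ∣ 1) (ℕ.+-monoʳ-≤ ℤ.∣ ↥ q ∣ (s≤s z≤n))) h)
  denominator : ⌈log₂ suc (↧ₙ q) ⌉ ≤ suc e
  denominator = ⌈log₂⌉≤ {suc (↧ₙ q)} (ℕ.+-mono-≤ (ℕ.m^n>0 2 e)
    (ℕ.≤-trans (ℕ.m≤n+m (↧ₙ q) ℤ.∣ ↥ q ∣) (ℕ.≤-trans h (ℕ.m≤m+n _ 0))))

-- Expected running times

-- Multiplying the averaging condition by the number of outcomes turns it into an inequality in `ℕ`,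
-- so that all later cost estimates stay within the naturals.
expectation-≤ : ∀ k (e : Fin (suc k) → ℚ) (y : Fin (suc k) → ℕ) {x} →
  (∀ i → e i ℚ.≤ fromℕ (y i)) → suc k + sum y ≤ suc k * x →
  1ℚ ℚ.+ (+ 1 ℚ./ suc k) ℚ.* sumℚ e ℚ.≤ fromℕ x
expectation-≤ k e y {x} e≤y y≤x = begin
  1ℚ ℚ.+ p ℚ.* sumℚ e                              ≤⟨ ℚ.+-monoʳ-≤ 1ℚ (ℚ.*-monoˡ-≤-nonNeg p (sum-mono e y e≤y)) ⟩
  1ℚ ℚ.+ p ℚ.* fromℕ (sum y)                       ≡⟨ cong (ℚ._+ p ℚ.* fromℕ (sum y)) (1/k*k≡1 k) ⟨
  p ℚ.* fromℕ (suc k) ℚ.+ p ℚ.* fromℕ (sum y)      ≡⟨ ℚ.*-distribˡ-+ p (fromℕ (suc k)) (fromℕ (sum y)) ⟨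
  p ℚ.* (fromℕ (suc k) ℚ.+ fromℕ (sum y))          ≡⟨ cong (p ℚ.*_) (fromℤ-+ (+ suc k) (+ sum y)) ⟨
  p ℚ.* fromℕ (suc k + sum y)                      ≤⟨ ℚ.*-monoˡ-≤-nonNeg p (fromℕ-mono-≤ y≤x) ⟩
  p ℚ.* fromℕ (suc k * x)                          ≡⟨ cong (λ i → p ℚ.* fromℤ i) (ℤ.pos-* (suc k) x) ⟩
  p ℚ.* fromℤ (+ suc k ℤ.* + x)                    ≡⟨ cong (p ℚ.*_) (fromℤ-* (+ suc k) (+ x)) ⟩
  p ℚ.* (fromℕ (suc k) ℚ.* fromℕ x)                ≡⟨ ℚ.*-assoc p (fromℕ (suc k)) (fromℕ x) ⟨
  p ℚ.* fromℕ (suc k) ℚ.* fromℕ x                  ≡⟨ cong (ℚ._* fromℕ x) (1/k*k≡1 k) ⟩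
  1ℚ ℚ.* fromℕ x                                   ≡⟨ ℚ.*-identityˡ (fromℕ x) ⟩
  fromℕ x ∎
  where
  open ℚ.≤-Reasoning
  p = + 1 ℚ./ suc k
  instance
    p≥0 : ℚ.NonNegative p
    p≥0 = ℚ.normalize-nonNeg 1 (suc k)
  sum-mono : ∀ {k} (e : Fin k → ℚ) (y : Fin k → ℕ) →
    (∀ i → e i ℚ.≤ fromℕ (y i)) → sumℚ e ℚ.≤ fromℕ (sum y)
  sum-mono {zero}  e y e≤y = ℚ.≤-refl
  sum-mono {suc k} e y e≤y = subst (sumℚ e ℚ.≤_) (sym (fromℤ-+ (+ y zero) (+ sum (y ∘ suc))))
    (ℚ.+-mono-≤ (e≤y zero) (sum-mono (e ∘ suc) (y ∘ suc) (e≤y ∘ suc)))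

module Runs {n m} (A : Vec (Vec ℚ n) m) (Safe Final : State → Set) where

  -- Within the next t steps from c, all states are safe, runs halt in final
  -- states only, and the expected number of steps is at most x.  The step
  -- index t lets while loops be treated by induction on t.
  Ok     : ℕ → Config → ℕ → Set
  OkMove : ℕ → Move → State → ℕ → Set

  Ok zero    c x = ⊤
  Ok (suc t) c x = Safe (proj₂ c) × OkMove t (step A c) (proj₂ c) x

  OkMove t halt       s x = Final s
  OkMove t (next k f) s x =
    Σ[ y ∈ (Fin (suc k) → ℕ) ] (∀ i → Ok t (f i) (y i)) × suc k + sum y ≤ suc k * x

  Ok⇒expectedSteps≤ : ∀ t c {x} → Ok t c x → expectedSteps A t c ℚ.≤ fromℕ x
  Ok⇒expectedSteps≤ zero    c {x} _ = fromℕ-mono-≤ {0} {x} z≤n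
  Ok⇒expectedSteps≤ (suc t) c {x} (_ , ok) with step A c
  ... | halt     = fromℕ-mono-≤ {0} {x} z≤n
  ... | next k f = let y , oks , y≤x = ok in
    expectation-≤ k (λ i → expectedSteps A t (f i)) y
      (λ i → Ok⇒expectedSteps≤ t (f i) (oks i)) y≤x

  Ok-successor : ∀ {c c′ t x} → Successor A c c′ → Ok (suc t) c x → ∃[ y ] Ok t c′ y
  Ok-successor (via eq i) (_ , ok) rewrite eq = let y , oks , _ = ok in y i , oks i

  -- Every move uses up one unit of the step index, so the hypothesis is required at all indices;
  -- the cost bound varies with the outcome, hence the existential.
  Ok-reachable : ∀ {P c} → (∀ t → ∃[ x ] Ok t (initial P A) x) →
    Reachable P A c → ∀ t → ∃[ x ] Ok t c x
  Ok-reachable ok steps = follow ok steps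
    where
    follow : ∀ {c c′} → (∀ t → ∃[ x ] Ok t c x) → Star (Successor A) c c′ →
      ∀ t → ∃[ x ] Ok t c′ x
    follow ok ε       = ok
    follow ok (s ◅ r) = follow (λ t → Ok-successor s (proj₂ (ok (suc t)))) r

  Ok-mono : ∀ t {c x x′} → x ≤ x′ → Ok t c x → Ok t c x′
  Ok-mono zero    x≤x′ ok = tt
  Ok-mono (suc t) {c} x≤x′ (safe , ok) with step A c
  ... | halt     = safe , ok
  ... | next k f = let y , oks , y≤x = ok in
    safe , y , oks , ℕ.≤-trans y≤x (ℕ.*-monoʳ-≤ (suc k) x≤x′)

  Ok-pred : ∀ t {c x} → Ok (suc t) c x → Ok t c x
  Ok-pred zero    ok = tt
  Ok-pred (suc t) {c} (safe , ok) with step A c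
  ... | halt     = safe , ok
  ... | next k f = let y , oks , y≤x = ok in
    safe , y , (λ i → Ok-pred t (oks i)) , y≤x

  Ok-step⁺ : ∀ t {c c′ x} → step A c ≡ continue c′ → Safe (proj₂ c) →
    Ok t c′ x → Ok (suc t) c (suc x)
  Ok-step⁺ t {x = x} eq safe ok rewrite eq = safe , (λ _ → x) , (λ _ → ok) ,
    ℕ.≤-reflexive (trans (cong suc (ℕ.+-identityʳ x)) (sym (ℕ.+-identityʳ (suc x))))

  -- Forgets the gain of one index in `Ok-step⁺`, so that straight-line code and counted loops keep
  -- `t` fixed; only the unbounded loop draws on the gain.
  Ok-step : ∀ t {c c′ x} → step A c ≡ continue c′ → Safe (proj₂ c) →
    Ok t c′ x → Ok t c (suc x)
  Ok-step zero    eq safe ok = tt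
  Ok-step (suc t) eq safe ok = Ok-step⁺ t eq safe (Ok-pred t ok)

  -- Cost rules for the individual commands.

  module _ (t : ℕ) {K : Program} {x : ℕ} {I : ℕ → ℕ} {D : ℕ → ℚ} (safe : Safe ⟨ I , D ⟩) where

    Ok-iconst : ∀ {r k} → Ok t (K , ⟨ I [ r ≔ k ] , D ⟩) x →
      Ok t (iconst r k ∷ K , ⟨ I , D ⟩) (suc x)
    Ok-iconst = Ok-step t refl safe

    -- Register contents enter through equations, so that the new state mentions values such as
    -- `n + i` instead of nested register lookups.
    Ok-iop : ∀ {∙ r u v k} → ⟦ ∙ ⟧ᵢ (I u) (I v) ≡ k → Ok t (K , ⟨ I [ r ≔ k ] , D ⟩) x →
      Ok t (iop ∙ r u v ∷ K , ⟨ I , D ⟩) (suc x)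
    Ok-iop refl = Ok-step t refl safe

    Ok-dconst : ∀ {r q k} → I r ≡ k → Ok t (K , ⟨ I , D [ k ≔ q ] ⟩) x →
      Ok t (dconst r q ∷ K , ⟨ I , D ⟩) (suc x)
    Ok-dconst refl = Ok-step t refl safe

    Ok-dop : ∀ {∙ r u v k q} → I r ≡ k → ⟦ ∙ ⟧ₐ (D (I u)) (D (I v)) ≡ q →
      Ok t (K , ⟨ I , D [ k ≔ q ] ⟩) x → Ok t (dop ∙ r u v ∷ K , ⟨ I , D ⟩) (suc x)
    Ok-dop refl refl = Ok-step t refl safe

    Ok-cast : ∀ {r u k l} → I r ≡ k → I u ≡ l →
      Ok t (K , ⟨ I , D [ k ≔ fromℕ l ] ⟩) x → Ok t (cast r u ∷ K , ⟨ I , D ⟩) (suc x)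
    Ok-cast refl refl = Ok-step t refl safe

    Ok-input : ∀ {r u v k i j} → I r ≡ k → I u ≡ i → I v ≡ j →
      Ok t (K , ⟨ I , D [ k ≔ entry A i j ] ⟩) x → Ok t (input r u v ∷ K , ⟨ I , D ⟩) (suc x)
    Ok-input refl refl refl = Ok-step t refl safe

    Ok-if-true : ∀ {b P Q} → holds b ⟨ I , D ⟩ ≡ true → Ok t (P ++ K , ⟨ I , D ⟩) x →
      Ok t (if b P Q ∷ K , ⟨ I , D ⟩) (suc x)
    Ok-if-true {P = P} {Q} eq = Ok-step t (cong (λ h → continue ((if h then P else Q) ++ K , ⟨ I , D ⟩)) eq) safe

    Ok-if-false : ∀ {b P Q} → holds b ⟨ I , D ⟩ ≡ false → Ok t (Q ++ K , ⟨ I , D ⟩) x →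
      Ok t (if b P Q ∷ K , ⟨ I , D ⟩) (suc x)
    Ok-if-false {P = P} {Q} eq = Ok-step t (cong (λ h → continue ((if h then P else Q) ++ K , ⟨ I , D ⟩)) eq) safe

    Ok-while-true⁺ : ∀ {b P} → holds b ⟨ I , D ⟩ ≡ true →
      Ok t (P ++ while b P ∷ K , ⟨ I , D ⟩) x → Ok (suc t) (while b P ∷ K , ⟨ I , D ⟩) (suc x)
    Ok-while-true⁺ {b} {P} eq =
      Ok-step⁺ t {while b P ∷ K , ⟨ I , D ⟩} (cong (λ h → continue ((if h then P ++ while b P ∷ K else K) , ⟨ I , D ⟩)) eq) safe

    Ok-while-true : ∀ {b P} → holds b ⟨ I , D ⟩ ≡ true →
      Ok t (P ++ while b P ∷ K , ⟨ I , D ⟩) x → Ok t (while b P ∷ K , ⟨ I , D ⟩) (suc x)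
    Ok-while-true {b} {P} eq =
      Ok-step t (cong (λ h → continue ((if h then P ++ while b P ∷ K else K) , ⟨ I , D ⟩)) eq) safe

    Ok-while-false : ∀ {b P} → holds b ⟨ I , D ⟩ ≡ false →
      Ok t (K , ⟨ I , D ⟩) x → Ok t (while b P ∷ K , ⟨ I , D ⟩) (suc x)
    Ok-while-false {b} {P} eq =
      Ok-step t (cong (λ h → continue ((if h then P ++ while b P ∷ K else K) , ⟨ I , D ⟩)) eq) safe

    Ok-uniform : ∀ {r u k} → I u ≡ k → (y : Fin (suc k) → ℕ) →
      (∀ i → Ok t (K , ⟨ I [ r ≔ toℕ i ] , D ⟩) (y i)) → suc k + sum y ≤ suc k * x →
      Ok t (uniform r u ∷ K , ⟨ I , D ⟩) x
    Ok-uniform refl y oks y≤z = Ok-pred t (safe , y , oks , y≤z)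

-- Sums and the union bound

module PrefixSum {C : Set} {_∙_ : Op₂ C} {ε : C} (isMonoid : IsMonoid _≡_ _∙_ ε) where
  open IsMonoid isMonoid using (assoc; identityˡ; identityʳ)

  prefix : (ℕ → C) → ℕ → C
  prefix f zero    = ε
  prefix f (suc j) = prefix f j ∙ f j

  prefix-cong : ∀ {f g} j → (∀ {l} → l < j → f l ≡ g l) → prefix f j ≡ prefix g j
  prefix-cong zero    f≡g = refl
  prefix-cong (suc j) f≡g = cong₂ _∙_ (prefix-cong j (f≡g ∘ ℕ.m<n⇒m<1+n)) (f≡g (ℕ.n<1+n j))

  -- `prefix` appends terms on the right, in the order in which columns are processed, while
  -- `Vec.foldr` peels them off on the left; associativity reconciles the two.
  prefix-suc : ∀ f j → prefix f (suc j) ≡ f 0 ∙ prefix (f ∘ suc) j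
  prefix-suc f zero    = trans (identityˡ (f 0)) (sym (identityʳ (f 0)))
  prefix-suc f (suc j) =
    trans (cong (_∙ f (suc j)) (prefix-suc f j)) (assoc (f 0) (prefix (f ∘ suc) j) (f (suc j)))

  prefix-foldr : ∀ {n} f (v : Vec C n) → (∀ i → f (toℕ i) ≡ lookup v i) →
    prefix f n ≡ Vec.foldr _ _∙_ ε v
  prefix-foldr f []      f≡v = refl
  prefix-foldr f (x ∷ v) f≡v = trans (prefix-suc f _)
    (cong₂ _∙_ (f≡v zero) (prefix-foldr (f ∘ suc) v (f≡v ∘ suc)))

open PrefixSum ℚ.+-0-isMonoid using () renaming
  (prefix to Σℚ; prefix-cong to Σℚ-cong; prefix-foldr to Σℚ-foldr)
open PrefixSum ℕ.+-0-isMonoid using () renaming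
  (prefix to Σℕ; prefix-foldr to Σℕ-foldr)

sum-mono-≤ : ∀ {k} {f g : Fin k → ℕ} → (∀ i → f i ≤ g i) → sum f ≤ sum g
sum-mono-≤ {zero}  f≤g = z≤n
sum-mono-≤ {suc k} f≤g = ℕ.+-mono-≤ (f≤g zero) (sum-mono-≤ (f≤g ∘ suc))

sum-affine : ∀ {k} b h (f : Fin k → ℕ) → sum (λ i → b + f i * h) ≡ k * b + sum f * h
sum-affine {zero}  b h f = refl
sum-affine {suc k} b h f = trans (cong (λ s → b + f zero * h + s) (sum-affine b h (f ∘ suc)))
  (rearrange b (f zero) h (k * b) (sum (f ∘ suc)))
  where
  rearrange : ∀ b f h x y → b + f * h + (x + y * h) ≡ b + x + (f + y) * h
  rearrange = solve-∀

indicator : {X : Set} → Dec X → ℕ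
indicator X? = if does X? then 1 else 0

sum-indicator≤1 : ∀ {k} {X : Fin k → Set} (X? : ∀ i → Dec (X i)) →
  (∀ {i j} → X i → X j → i ≡ j) → sum (λ i → indicator (X? i)) ≤ 1
sum-indicator≤1 {zero}  X? unique = z≤n
sum-indicator≤1 {suc k} X? unique with X? zero
... | no  _ = sum-indicator≤1 (X? ∘ suc) (λ x y → Fin.suc-injective (unique x y))
... | yes x = s≤s (ℕ.≤-reflexive (none (X? ∘ suc) (λ i y → contradiction (unique x y) λ ())))
  where
  none : ∀ {k} {X : Fin k → Set} (X? : ∀ i → Dec (X i)) → (∀ i → ¬ X i) →
    sum (λ i → indicator (X? i)) ≡ 0
  none {zero}  X? ¬X = refl
  none {suc k} X? ¬X rewrite dec-false (X? zero) (¬X zero) = none (X? ∘ suc) (¬X ∘ suc)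

-- Bad values of a coordinate and the failure flag.

Bad : ℚ → ℚ → Set
Bad a v = a ≢ 0ℚ × v ≡ 0ℚ

bad? : ∀ a v → Dec (Bad a v)
bad? a v = ¬? (a ℚ.≟ 0ℚ) ×-dec (v ℚ.≟ 0ℚ)

¬bad⇒ : ∀ {a v} → ¬ Bad a v → a ≡ 0ℚ ⊎ v ≢ 0ℚ
¬bad⇒ {a} ¬bad with a ℚ.≟ 0ℚ
... | yes a≡0 = inj₁ a≡0
... | no  a≢0 = inj₂ (λ v≡0 → ¬bad (a≢0 , v≡0))

-- Models register 12 after `i` rows of a scan, where `a` is the new column and `v` lists the
-- extended sums. Its values are naturals so that summing over the draws counts the failing ones.
flag : (a v : ℕ → ℚ) → ℕ → ℕ
flag a v zero    = 0
flag a v (suc i) = if does (bad? (a i) (v i)) then 1 else flag a v i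

flag-bad : ∀ a v i → Bad (a i) (v i) → flag a v (suc i) ≡ 1
flag-bad a v i bad rewrite dec-true (bad? (a i) (v i)) bad = refl

flag-¬bad : ∀ a v i → ¬ Bad (a i) (v i) → flag a v (suc i) ≡ flag a v i
flag-¬bad a v i ¬bad rewrite dec-false (bad? (a i) (v i)) ¬bad = refl

flag-0⊎1 : ∀ a v i → flag a v i ≡ 0 ⊎ flag a v i ≡ 1
flag-0⊎1 a v zero    = inj₁ refl
flag-0⊎1 a v (suc i) with does (bad? (a i) (v i))
... | true  = inj₂ refl
... | false = flag-0⊎1 a v i

flag≡0⇒¬bad : ∀ a v i → flag a v i ≡ 0 → ∀ {k} → k < i → ¬ Bad (a k) (v k)
flag≡0⇒¬bad a v (suc i) f≡0 k<1+i with bad? (a i) (v i) | ℕ.m<1+n⇒m<n∨m≡n k<1+i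
... | yes bad | _         = contradiction (trans (sym (flag-bad a v i bad)) f≡0) λ ()
... | no ¬bad | inj₂ refl = ¬bad
... | no ¬bad | inj₁ k<i  = flag≡0⇒¬bad a v i (trans (sym (flag-¬bad a v i ¬bad)) f≡0) k<i

-- Union bound by induction on the rows: each row spoils at most one draw, so it raises the number
-- of failing draws by at most one.
sum-flag≤ : ∀ {k} a (v : Fin k → ℕ → ℚ) i →
  (∀ {l} → l < i → ∀ {u u′} → Bad (a l) (v u l) → Bad (a l) (v u′ l) → u ≡ u′) →
  sum (λ u → flag a (v u) i) ≤ i
sum-flag≤ {k} a v zero unique =
  ℕ.≤-reflexive (trans (sum-affine {k} 0 0 (λ _ → 0)) (cong₂ _+_ (ℕ.*-zeroʳ k) (ℕ.*-zeroʳ (sum {k} (λ _ → 0)))))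
sum-flag≤ a v (suc i) unique = begin
  sum (λ u → flag a (v u) (suc i))
    ≤⟨ sum-mono-≤ split ⟩
  sum (λ u → indicator (bad? (a i) (v u i)) + flag a (v u) i)
    ≡⟨ ∑-distrib-+ (λ u → indicator (bad? (a i) (v u i))) (λ u → flag a (v u) i) ⟩
  sum (λ u → indicator (bad? (a i) (v u i))) + sum (λ u → flag a (v u) i)
    ≤⟨ ℕ.+-mono-≤ (sum-indicator≤1 (λ u → bad? (a i) (v u i)) (unique (ℕ.n<1+n i)))
                  (sum-flag≤ a v i (unique ∘ ℕ.m<n⇒m<1+n)) ⟩
  suc i ∎
  where
  open ℕ.≤-Reasoning
  split : ∀ u → flag a (v u) (suc i) ≤ indicator (bad? (a i) (v u i)) + flag a (v u) i
  split u with does (bad? (a i) (v u i))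
  ... | true  = s≤s z≤n
  ... | false = ℕ.≤-refl

affine-root-unique : ∀ {a} b {p q} → a ≢ 0ℚ → b ℚ.+ a ℚ.* p ≡ 0ℚ → b ℚ.+ a ℚ.* q ≡ 0ℚ → p ≡ q
affine-root-unique {a} b {p} {q} a≢0 p-root q-root = begin
  p                        ≡⟨ cancel p ⟨
  (ℚ.1/ a) ℚ.* (a ℚ.* p)   ≡⟨ cong ((ℚ.1/ a) ℚ.*_) (Group.∙-cancelˡ ℚ.+-0-group b _ _ (trans p-root (sym q-root))) ⟩
  (ℚ.1/ a) ℚ.* (a ℚ.* q)   ≡⟨ cancel q ⟩
  q ∎
  where
  open ≡-Reasoning
  instance
    nz : ℚ.NonZero a
    nz = ℚ.≢-nonZero a≢0
  cancel : ∀ r → (ℚ.1/ a) ℚ.* (a ℚ.* r) ≡ r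
  cancel r = trans (sym (ℚ.*-assoc (ℚ.1/ a) a r))
    (trans (cong (ℚ._* r) (ℚ.*-inverseˡ a)) (ℚ.*-identityˡ r))

-- The range of the coordinates, input entries, norms and memory updates.

centred : ∀ m → Fin (suc (m + m)) → ℤ
centred m u = + toℕ u ℤ.- + m

∣centred∣≤m : ∀ m u → ℤ.∣ centred m u ∣ ≤ m
∣centred∣≤m m u rewrite ℤ.[+m]-[+n]≡m⊖n (toℕ u) m with ℕ.≤-total (toℕ u) m
... | inj₁ u≤m rewrite ℤ.∣⊖∣-≤ u≤m = ℕ.m∸n≤m m (toℕ u)
... | inj₂ m≤u rewrite ℤ.∣m⊖n∣≡∣n⊖m∣ (toℕ u) m | ℤ.∣⊖∣-≤ m≤u =
  ℕ.m≤n+o⇒m∸n≤o (toℕ u) m (ℕ.≤-pred (Fin.toℕ<n u))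

centred-injective : ∀ m {u v} → centred m u ≡ centred m v → u ≡ v
centred-injective m eq = Fin.toℕ-injective (ℤ.+-injective
  (Group.∙-cancelʳ (AbelianGroup.group ℤ.+-0-abelianGroup) (ℤ.- + m) _ _ eq))

entry-lookup : ∀ {n m} (A : Vec (Vec ℚ n) m) i j →
  entry A (toℕ i) (toℕ j) ≡ lookup (lookup A i) j
entry-lookup {n} {m} A i j with toℕ i ℕ.<? m | toℕ j ℕ.<? n
... | yes i<m | yes j<n rewrite Fin.fromℕ<-toℕ i i<m | Fin.fromℕ<-toℕ j j<n = refl
... | no  i≮m | _       = contradiction (Fin.toℕ<n i) i≮m
... | yes _   | no j≮n  = contradiction (Fin.toℕ<n j) j≮n

lookup≤sum : ∀ {m} {X : Set} (f : X → ℕ) (v : Vec X m) i → f (lookup v i) ≤ Vec.sum (Vec.map f v)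
lookup≤sum f (x ∷ v) zero    = ℕ.m≤m+n (f x) _
lookup≤sum f (x ∷ v) (suc i) = ℕ.≤-trans (lookup≤sum f v i) (ℕ.m≤n+m _ (f x))

-- As each entry takes at least one bit, this bounds the number of columns by the size of a row, and
-- with it the contribution of the coordinates to the size of a partial sum.
length≤sum : ∀ {m} {X : Set} (f : X → ℕ) → (∀ x → 1 ≤ f x) → (v : Vec X m) → m ≤ Vec.sum (Vec.map f v)
length≤sum f 1≤f []      = z≤n
length≤sum f 1≤f (x ∷ v) = ℕ.+-mono-≤ (1≤f x) (length≤sum f 1≤f v)

‖‖∞≤ : ∀ {k b} (z : Vec ℤ k) → (∀ i → ℤ.∣ lookup z i ∣ ≤ b) → ‖ z ‖∞ ≤ b
‖‖∞≤ []      z≤b = z≤n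
‖‖∞≤ (_ ∷ z) z≤b = ℕ.⊔-lub (z≤b zero) (‖‖∞≤ z (z≤b ∘ suc))

lookup≡0⇒≡replicate : ∀ {k} (a : Vec ℚ k) → (∀ i → lookup a i ≡ 0ℚ) → a ≡ replicate k 0ℚ
lookup≡0⇒≡replicate []      a≡0 = refl
lookup≡0⇒≡replicate (_ ∷ a) a≡0 = cong₂ _∷_ (a≡0 zero) (lookup≡0⇒≡replicate a (a≡0 ∘ suc))

module _ {X : Set} (f : ℕ → X) where

  ≔-same : ∀ k {x} → (f [ k ≔ x ]) k ≡ x
  ≔-same k rewrite dec-true (k ℕ.≟ k) refl = refl

  ≔-other : ∀ {k l x} → k ≢ l → (f [ k ≔ x ]) l ≡ f l
  ≔-other {k} {l} k≢l rewrite dec-false (k ℕ.≟ l) k≢l = refl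

  ≔-all : ∀ k x (P : X → Set) → (∀ l → P (f l)) → P x → ∀ l → P ((f [ k ≔ x ]) l)
  ≔-all k x P all Px l with does (k ℕ.≟ l)
  ... | true  = Px
  ... | false = all l

-- The algorithm

-- Index registers: 0, 1 hold n, m; 2, 3 hold 0, 1; 4 holds 2m; 5 to 8 hold
-- the addresses n+m to n+m+3; 9 is j, 10 is i, 11 is the random
-- number (z_j shifted by m), 12 is the failure flag and 13 is n+i.
-- Data cells: j < n holds z_j; n+i holds the partial sum of the i-th vector;
-- n+m is scratch; n+m+1, n+m+2 hold 0, m; n+m+3 holds the change of z_j.

addTerm scanBody scanLoop attempt retryLoop columnBody columnLoop setup program : Program

addTerm =
  dop mul 5 5 8 ∷
  iop add 13 0 10 ∷
  dop add 13 13 5 ∷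
  if (data≡ 13 6) (iconst 12 1 ∷ []) [] ∷
  []

scanBody =
  input 5 10 9 ∷
  -- A zero coefficient leaves the sum unchanged and is exempt from the test, in accordance with
  -- `Bad`.
  if (data≡ 5 6) [] addTerm ∷
  iop add 10 10 3 ∷
  []

scanLoop = while (index< 10 1) scanBody ∷ []

attempt =
  -- The old coordinate is saved, negated, before cell `j` is overwritten; adding the new one then
  -- gives the change.
  dop sub 8 6 9 ∷
  cast 9 11 ∷
  dop sub 9 9 7 ∷
  dop add 8 8 9 ∷
  iconst 12 0 ∷
  iconst 10 0 ∷
  scanLoop

retryLoop = while (index< 2 12) (uniform 11 4 ∷ attempt) ∷ []

columnBody =
  -- The stored sums do not yet involve column `j`, so they are consistent with `z_j = 0`; the
  -- raised flag forces a first draw.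
  dconst 9 0ℚ ∷
  iconst 12 1 ∷
  retryLoop ++
  iop add 9 9 3 ∷
  []

columnLoop = while (index< 9 0) columnBody ∷ []

setup =
  iop add 4 1 1 ∷
  iop add 5 0 1 ∷
  iop add 6 5 3 ∷
  iop add 7 6 3 ∷
  iop add 8 7 3 ∷
  -- The zero cell, by contrast, is never written and keeps its initial value.
  cast 7 1 ∷
  columnLoop

program =
  iconst 3 1 ∷
  -- For `m = 0` a pass over `n` columns would exceed the budget, which is then constant; the
  -- initial memory already holds the zero vector as output.
  if (index< 2 1) setup [] ∷
  []

-- Addresses and bounds on the numbers held in memory.

module _ {n m} (A : Vec (Vec ℚ n) m) where

  -- In `maxIndex`, the summand `m` makes room for the content `2m` of register 4 when `n` is small.
  -- In `maxLog`, the linear term pays for the entries of a row and the square for up to `n`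
  -- coordinates of size `sizeℕ m`.
  scratch zeroCell mCell changeCell maxIndex maxLog : ℕ
  scratch    = n + m
  zeroCell   = scratch + 1
  mCell      = zeroCell + 1
  changeCell = mCell + 1
  maxIndex   = changeCell + m
  maxLog     = inputSize A + inputSize A * inputSize A

  k<k+1 : ∀ k → k < k + 1
  k<k+1 k = ℕ.≤-reflexive (ℕ.+-comm 1 k)

  scratch<zeroCell : scratch < zeroCell
  scratch<zeroCell = k<k+1 scratch

  scratch<mCell : scratch < mCell
  scratch<mCell = ℕ.<-trans scratch<zeroCell (k<k+1 zeroCell)

  scratch<changeCell : scratch < changeCell
  scratch<changeCell = ℕ.<-trans scratch<mCell (k<k+1 mCell)

  scratch≤maxIndex : scratch ≤ maxIndex
  scratch≤maxIndex = ℕ.m≤n⇒m≤n+o m (ℕ.<⇒≤ scratch<changeCell)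

  n≤maxIndex : n ≤ maxIndex
  n≤maxIndex = ℕ.≤-trans (ℕ.m≤m+n n m) scratch≤maxIndex

  m≤maxIndex : m ≤ maxIndex
  m≤maxIndex = ℕ.m≤n+m m changeCell

  2m≤maxIndex : m + m ≤ maxIndex
  2m≤maxIndex = ℕ.+-monoˡ-≤ m (ℕ.≤-trans (ℕ.m≤n+m m n) (ℕ.<⇒≤ scratch<changeCell))

  1≤maxIndex : 1 ≤ maxIndex
  1≤maxIndex = ℕ.m≤n⇒m≤n+o m (ℕ.m≤n+m 1 mCell)

  column<scratch : ∀ {j} → j < n → j < scratch
  column<scratch j<n = ℕ.m≤n⇒m≤n+o m j<n

  sum<scratch : ∀ {i} → i < m → n + i < scratch
  sum<scratch = ℕ.+-monoʳ-< n

  Safe : State → Set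
  Safe s = (∀ k → I s k ≤ maxIndex) × (∀ k → height (D s k) ≤ 2 ^ maxLog)

  Final : State → Set
  Final s = Σ[ z ∈ Vec ℤ n ] (Outputs s z × (∀ a → a ∈ A → a ᵀ z ≢ 0ℚ) × ‖ z ‖∞ ≤ m)

  open Runs A Safe Final

  safe-≔ᵢ : ∀ r {k I D} → k ≤ maxIndex → Safe ⟨ I , D ⟩ → Safe ⟨ I [ r ≔ k ] , D ⟩
  safe-≔ᵢ r {k} {I} k≤ (I≤ , D≤) = ≔-all I r k (_≤ maxIndex) I≤ k≤ , D≤

  safe-≔ : ∀ k {q I D} → height q ≤ 2 ^ maxLog → Safe ⟨ I , D ⟩ → Safe ⟨ I , D [ k ≔ q ] ⟩
  safe-≔ k {q} {D = D} q≤ (I≤ , D≤) = I≤ , ≔-all D k q (λ q → height q ≤ 2 ^ maxLog) D≤ q≤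

  partial : (ℕ → ℤ) → ℕ → ℕ → ℚ
  partial ζ j i = Σℚ (λ l → entry A i l ℚ.* fromℤ (ζ l)) j

  extended : (ℕ → ℤ) → ℕ → ℤ → ℕ → ℚ
  extended ζ j w i = partial ζ j i ℚ.+ entry A i j ℚ.* fromℤ w

  partial-≔ : ∀ ζ j w i → partial (ζ [ j ≔ w ]) (suc j) i ≡ extended ζ j w i
  partial-≔ ζ j w i = cong₂ ℚ._+_
    (Σℚ-cong j λ l<j →
      cong (λ k → entry A i _ ℚ.* fromℤ k) (≔-other ζ (ℕ.<⇒≢ l<j ∘ sym)))
    (cong (λ k → entry A i j ℚ.* fromℤ k) (≔-same ζ j))

  -- An exponent of 2 bounding the height of a partial sum: heights multiply under both operations,
  -- so each term contributes the size of its entry plus that of a coordinate.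
  logBound : ℕ → ℕ → ℕ
  logBound i j = Σℕ (λ l → sizeℚ (entry A i l)) j + j * sizeℕ m

  logBound-suc : ∀ i j → logBound i (suc j) ≡ logBound i j + (sizeℚ (entry A i j) + sizeℕ m)
  logBound-suc i j = rearrange (Σℕ (λ l → sizeℚ (entry A i l)) j) (sizeℚ (entry A i j)) (sizeℕ m) (j * sizeℕ m)
    where
    rearrange : ∀ a b c d → a + b + (c + d) ≡ a + d + (b + c)
    rearrange = solve-∀

  logBound-mono : ∀ i {j k} → j ≤ k → logBound i j ≤ logBound i k
  logBound-mono i {j} {k} j≤k with ℕ.m≤n⇒∃[o]m+o≡n j≤k
  ... | o , refl = grow o
    where
    grow : ∀ o → logBound i j ≤ logBound i (j + o)
    grow zero    rewrite ℕ.+-identityʳ j = ℕ.≤-refl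
    grow (suc o) rewrite ℕ.+-suc j o | logBound-suc i (j + o) = ℕ.m≤n⇒m≤n+o _ (grow o)

  sizeℕm≤inputSize : sizeℕ m ≤ inputSize A
  sizeℕm≤inputSize = ℕ.m≤n⇒m≤n+o _ (ℕ.m≤n+m (sizeℕ m) (sizeℕ n))

  sizeℕn≤inputSize : sizeℕ n ≤ inputSize A
  sizeℕn≤inputSize = ℕ.m≤n⇒m≤n+o _ (ℕ.m≤m+n (sizeℕ n) (sizeℕ m))

  logBound-row≤ : ∀ i → logBound (toℕ i) n ≤ maxLog
  logBound-row≤ i = ℕ.+-mono-≤ (ℕ.≤-trans (ℕ.≤-reflexive entries≡) row≤)
    (ℕ.*-mono-≤ (ℕ.≤-trans (length≤sum sizeℚ (λ _ → s≤s z≤n) (lookup A i)) row≤) sizeℕm≤inputSize)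
    where
    entries≡ : Σℕ (λ l → sizeℚ (entry A (toℕ i) l)) n ≡ Vec.sum (Vec.map sizeℚ (lookup A i))
    entries≡ = Σℕ-foldr _ (Vec.map sizeℚ (lookup A i)) λ l →
      trans (cong sizeℚ (entry-lookup A i l)) (sym (Vec.lookup-map l sizeℚ (lookup A i)))
    row≤ : Vec.sum (Vec.map sizeℚ (lookup A i)) ≤ inputSize A
    row≤ = ℕ.≤-trans (lookup≤sum (λ a → Vec.sum (Vec.map sizeℚ a)) A i) (ℕ.m≤n+m _ (sizeℕ n + sizeℕ m))

  logBound≤ : ∀ {i j} → i < m → j ≤ n → logBound i j ≤ maxLog
  logBound≤ {i} i<m j≤n = ℕ.≤-trans (logBound-mono i j≤n)
    (subst (λ i → logBound i n ≤ maxLog) (Fin.toℕ-fromℕ< i<m) (logBound-row≤ (fromℕ< i<m)))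

  2m<2^sizeℕm : suc (m + m) ≤ 2 ^ sizeℕ m
  2m<2^sizeℕm = ℕ.≤-trans (s≤s (ℕ.+-monoʳ-≤ m (ℕ.m≤n⇒m≤1+n (ℕ.m≤m+n m 0)))) (2*suc≤2^sizeℕ m)

  height-fromℤ≤ : ∀ k → ℤ.∣ k ∣ ≤ m + m → height (fromℤ k) ≤ 2 ^ sizeℕ m
  height-fromℤ≤ k k≤2m = ℕ.≤-trans (ℕ.≤-reflexive (height-fromℤ k)) (ℕ.≤-trans (s≤s k≤2m) 2m<2^sizeℕm)

  height-fromℤ≤max : ∀ k → ℤ.∣ k ∣ ≤ m + m → height (fromℤ k) ≤ 2 ^ maxLog
  height-fromℤ≤max k k≤2m = ℕ.≤-trans (height-fromℤ≤ k k≤2m)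
    (ℕ.^-monoʳ-≤ 2 (ℕ.m≤n⇒m≤n+o _ sizeℕm≤inputSize))

  height-product≤ : ∀ i j {q} → height q ≤ 2 ^ sizeℕ m →
    height (entry A i j ℚ.* q) ≤ 2 ^ (sizeℚ (entry A i j) + sizeℕ m)
  height-product≤ i j {q} q≤ = begin
    height (entry A i j ℚ.* q)                      ≤⟨ height-* (entry A i j) q ⟩
    height (entry A i j) * height q                 ≤⟨ ℕ.*-mono-≤ (height≤2^sizeℚ (entry A i j)) q≤ ⟩
    2 ^ sizeℚ (entry A i j) * 2 ^ sizeℕ m           ≡⟨ ℕ.^-distribˡ-+-* 2 (sizeℚ (entry A i j)) (sizeℕ m) ⟨
    2 ^ (sizeℚ (entry A i j) + sizeℕ m) ∎
    where open ℕ.≤-Reasoning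

  height-extended≤ : ∀ ζ → (∀ l → ℤ.∣ ζ l ∣ ≤ m) → ∀ w → ℤ.∣ w ∣ ≤ m → ∀ i j →
    height (extended ζ j w i) ≤ 2 ^ logBound i (suc j)
  height-partial≤ : ∀ ζ → (∀ l → ℤ.∣ ζ l ∣ ≤ m) → ∀ i j →
    height (partial ζ j i) ≤ 2 ^ logBound i j

  height-extended≤ ζ ζ≤ w w≤ i j = begin
    height (extended ζ j w i)
      ≤⟨ height-+ (partial ζ j i) (entry A i j ℚ.* fromℤ w) ⟩
    height (partial ζ j i) * height (entry A i j ℚ.* fromℤ w)
      ≤⟨ ℕ.*-mono-≤ (height-partial≤ ζ ζ≤ i j) (height-product≤ i j (height-fromℤ≤ w (ℕ.m≤n⇒m≤n+o m w≤))) ⟩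
    2 ^ logBound i j * 2 ^ (sizeℚ (entry A i j) + sizeℕ m)
      ≡⟨ ℕ.^-distribˡ-+-* 2 (logBound i j) (sizeℚ (entry A i j) + sizeℕ m) ⟨
    2 ^ (logBound i j + (sizeℚ (entry A i j) + sizeℕ m))
      ≡⟨ cong (2 ^_) (logBound-suc i j) ⟨
    2 ^ logBound i (suc j) ∎
    where open ℕ.≤-Reasoning

  height-partial≤ ζ ζ≤ i zero    = s≤s z≤n
  -- One more column is by definition an extension by the coordinate `ζ j`; hence the mutual
  -- recursion.
  height-partial≤ ζ ζ≤ i (suc j) = height-extended≤ ζ ζ≤ (ζ j) (ζ≤ j) i j

  module _ {i j} (i<m : i < m) (j<n : j < n) where

    logBound-entry≤ : sizeℚ (entry A i j) + sizeℕ m ≤ maxLog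
    logBound-entry≤ = ℕ.≤-trans (ℕ.m≤n+m _ (logBound i j))
      (ℕ.≤-trans (ℕ.≤-reflexive (sym (logBound-suc i j))) (logBound≤ i<m j<n))

    height-entry≤max : height (entry A i j) ≤ 2 ^ maxLog
    height-entry≤max = ℕ.≤-trans (height≤2^sizeℚ (entry A i j))
      (ℕ.^-monoʳ-≤ 2 (ℕ.≤-trans (ℕ.m≤m+n _ (sizeℕ m)) logBound-entry≤))

    height-product≤max : ∀ {q} → height q ≤ 2 ^ sizeℕ m → height (entry A i j ℚ.* q) ≤ 2 ^ maxLog
    height-product≤max q≤ = ℕ.≤-trans (height-product≤ i j q≤) (ℕ.^-monoʳ-≤ 2 logBound-entry≤)

    height-extended≤max : ∀ ζ → (∀ l → ℤ.∣ ζ l ∣ ≤ m) → ∀ w → ℤ.∣ w ∣ ≤ m →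
      height (extended ζ j w i) ≤ 2 ^ maxLog
    height-extended≤max ζ ζ≤ w w≤ =
      ℕ.≤-trans (height-extended≤ ζ ζ≤ w w≤ i j) (ℕ.^-monoʳ-≤ 2 (logBound≤ i<m j<n))

  -- Twice the cost of one attempt (including the loop test), plus slack:
  -- an attempt succeeds with probability at least 1/2.
  attemptCost retryCost : ℕ
  attemptCost = 7 + m * 9
  retryCost   = suc (2 * (attemptCost + 2))

  -- Invariants of the memory.

  record Frame (I : ℕ → ℕ) : Set where
    field
      I0 : I 0 ≡ n
      I1 : I 1 ≡ m
      I2 : I 2 ≡ 0
      I3 : I 3 ≡ 1
      I4 : I 4 ≡ m + m
      I5 : I 5 ≡ scratch
      I6 : I 6 ≡ zeroCell
      I7 : I 7 ≡ mCell
      I8 : I 8 ≡ changeCell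

  -- With the index in the form `9 + r`, its comparisons with 0 to 8 compute, and every field
  -- carries over as it stands.
  frame-≔ : ∀ {I} r {k} → Frame I → Frame (I [ 9 + r ≔ k ])
  frame-≔ r F = record
    { I0 = I0 ; I1 = I1 ; I2 = I2 ; I3 = I3 ; I4 = I4 ; I5 = I5 ; I6 = I6 ; I7 = I7 ; I8 = I8 }
    where open Frame F

  -- The part of the invariant that persists in the middle of a scan; the partial sums are described
  -- separately, because a scan changes them one by one.
  record Layout (j : ℕ) (ζ : ℕ → ℤ) (I : ℕ → ℕ) (D : ℕ → ℚ) : Set where
    field
      frame : Frame I
      I9    : I 9 ≡ j
      safe  : Safe ⟨ I , D ⟩
      zero≡ : D zeroCell ≡ 0ℚ
      m≡    : D mCell ≡ fromℕ m
      ζ≡    : ∀ {l} → l < j → D l ≡ fromℤ (ζ l)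
    open Frame frame public

  layout-≔ᵢ : ∀ r {k j ζ I D} → k ≤ maxIndex → Layout j ζ I D → Layout j ζ (I [ 10 + r ≔ k ]) D
  layout-≔ᵢ r {D = D} k≤ L = record
    { frame = frame-≔ (suc r) frame ; I9 = I9
    ; safe = safe-≔ᵢ (10 + r) {D = D} k≤ safe
    ; zero≡ = zero≡ ; m≡ = m≡ ; ζ≡ = ζ≡ }
    where open Layout L

  record Writable (j k : ℕ) : Set where
    field
      j≤k : j ≤ k
      k≢Z : k ≢ zeroCell
      k≢M : k ≢ mCell

  layout-≔ : ∀ {k q j ζ I D} → Writable j k → height q ≤ 2 ^ maxLog →
    Layout j ζ I D → Layout j ζ I (D [ k ≔ q ])
  layout-≔ {k} {D = D} W q≤ L = record
    { frame = frame ; I9 = I9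
    ; safe = safe-≔ k q≤ safe
    ; zero≡ = trans (≔-other D k≢Z) zero≡ ; m≡ = trans (≔-other D k≢M) m≡
    ; ζ≡ = λ l<j → trans (≔-other D (ℕ.<⇒≢ (ℕ.<-≤-trans l<j j≤k) ∘ sym)) (ζ≡ l<j) }
    where
    open Layout L
    open Writable W

  writable-≤scratch : ∀ {j k} → j ≤ k → k ≤ scratch → Writable j k
  writable-≤scratch j≤k k≤ = record
    { j≤k = j≤k
    ; k≢Z = ℕ.<⇒≢ (ℕ.≤-<-trans k≤ scratch<zeroCell)
    ; k≢M = ℕ.<⇒≢ (ℕ.≤-<-trans k≤ scratch<mCell) }

  writable-changeCell : ∀ {j} → j < n → Writable j changeCell
  writable-changeCell j<n = record
    { j≤k = ℕ.<⇒≤ (ℕ.<-trans (column<scratch j<n) scratch<changeCell)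
    ; k≢Z = ℕ.<⇒≢ (ℕ.<-trans (k<k+1 zeroCell) (k<k+1 mCell)) ∘ sym
    ; k≢M = ℕ.<⇒≢ (k<k+1 mCell) ∘ sym }

  -- Choosing one coordinate: the scan and the retry loop.

  module Column {j} (j<n : j < n) (ζ : ℕ → ℤ) (ζ≤m : ∀ l → ℤ.∣ ζ l ∣ ≤ m) where

    j<scratch : j < scratch
    j<scratch = column<scratch j<n

    writable-scratch : Writable j scratch
    writable-scratch = writable-≤scratch (ℕ.<⇒≤ j<scratch) ℕ.≤-refl

    column : ℕ → ℚ
    column i = entry A i j

    failure : ℤ → ℕ → ℕ
    failure w = flag column (extended ζ j w)

    module Scan w (w≤m : ℤ.∣ w ∣ ≤ m) δ (δ≤ : height δ ≤ 2 ^ sizeℕ m) where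

      record Scanned (i : ℕ) (I : ℕ → ℕ) (D : ℕ → ℚ) : Set where
        field
          layout : Layout j ζ I D
          I10    : I 10 ≡ i
          I12    : I 12 ≡ failure w i
          change≡ : D changeCell ≡ δ
          w≡     : D j ≡ fromℤ w
          done   : ∀ {k} → k < i → D (n + k) ≡ extended ζ j w k
          todo   : ∀ {k} → i ≤ k → k < m → D (n + k) ℚ.+ column k ℚ.* δ ≡ extended ζ j w k
        open Layout layout public

      advance : ∀ {i I D I′ D′} → i < m → Scanned i I D → Layout j ζ I′ D′ →
        I′ 10 ≡ suc i → I′ 12 ≡ failure w (suc i) →
        D′ (n + i) ≡ extended ζ j w i →
        (∀ {k} → k ≢ scratch → k ≢ n + i → D′ k ≡ D k) → Scanned (suc i) I′ D′
      advance {i} i<m S L I′10 I′12 sum≡ same = record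
        { layout = L ; I10 = I′10 ; I12 = I′12
        ; change≡ = trans (same (ℕ.<⇒≢ scratch<changeCell ∘ sym)
            (ℕ.<⇒≢ (ℕ.<-trans (sum<scratch i<m) scratch<changeCell) ∘ sym)) change≡
        ; w≡ = trans (same (ℕ.<⇒≢ j<scratch) (ℕ.<⇒≢ (ℕ.<-≤-trans j<n (ℕ.m≤m+n n i)))) w≡
        ; done = done′
        ; todo = λ {k} i<k k<m → trans
            (cong (ℚ._+ column k ℚ.* δ) (same (ℕ.<⇒≢ (sum<scratch k<m)) (ℕ.<⇒≢ (ℕ.+-monoʳ-< n i<k) ∘ sym)))
            (todo (ℕ.<⇒≤ i<k) k<m) }
        where
        open Scanned S
        done′ : ∀ {k} → k < suc i → _
        done′ k<1+i with ℕ.m<1+n⇒m<n∨m≡n k<1+i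
        ... | inj₂ refl = sum≡
        ... | inj₁ k<i  = trans
          (same (ℕ.<⇒≢ (sum<scratch (ℕ.<-trans k<i i<m))) (ℕ.<⇒≢ (ℕ.+-monoʳ-< n k<i))) (done k<i)

      -- Induction on the number `r` of rows left. The longest path through a row has 9 steps: loop
      -- test, input, zero test, three operations and a test in `addTerm`, setting the flag,
      -- increment.
      Ok-scan : ∀ r t {K x i I D} → r + i ≡ m → Scanned i I D →
        (∀ {I D} → Scanned m I D → Ok t (K , ⟨ I , D ⟩) x) →
        Ok t (scanLoop ++ K , ⟨ I , D ⟩) (r * 9 + suc x)
      Ok-scan zero t {I = I} refl S exit =
        Ok-while-false t safe (dec-false (I 10 ℕ.<? I 1) (ℕ.<-irrefl (trans I10 (sym I1)))) (exit S)
        where open Scanned S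
      Ok-scan (suc r) t {K} {x} {i} {I} {D} r+i≡m S exit =
        Ok-while-true t safe (dec-true (I 10 ℕ.<? I 1) (subst₂ _<_ (sym I10) (sym I1) i<m)) $
        Ok-input t safe I5 I10 I9 $
        body (column i ℚ.≟ 0ℚ) (extended ζ j w i ℚ.≟ 0ℚ)
        where
        open Scanned S
        i<m : i < m
        i<m = ℕ.m+n≤o⇒n≤o r (ℕ.≤-reflexive (trans (ℕ.+-suc r i) r+i≡m))
        n+i<scratch : n + i < scratch
        n+i<scratch = sum<scratch i<m
        a = column i
        v = extended ζ j w i
        rest = r * 9 + suc x

        D₁ D₂ D₃ : ℕ → ℚ
        D₁ = D [ scratch ≔ a ]
        D₂ = D₁ [ scratch ≔ a ℚ.* δ ]
        D₃ = D₂ [ n + i ≔ v ]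
        I₃ : ℕ → ℕ
        I₃ = I [ 13 ≔ n + i ]

        L₁ : Layout j ζ I D₁
        L₁ = layout-≔ writable-scratch (height-entry≤max i<m j<n) layout
        L₂ : Layout j ζ I D₂
        L₂ = layout-≔ writable-scratch (height-product≤max i<m j<n δ≤) L₁
        L₂′ : Layout j ζ I₃ D₂
        L₂′ = layout-≔ᵢ 3 (ℕ.≤-trans (ℕ.<⇒≤ n+i<scratch) scratch≤maxIndex) L₂
        L₃ : Layout j ζ I₃ D₃
        L₃ = layout-≔ (writable-≤scratch (ℕ.<⇒≤ (ℕ.<-≤-trans j<n (ℕ.m≤m+n n i))) (ℕ.<⇒≤ n+i<scratch))
               (height-extended≤max i<m j<n ζ ζ≤m w w≤m) L₂′

        loaded : D₁ (I 5) ≡ a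
        loaded = trans (cong D₁ I5) (≔-same D scratch)

        next-row : ∀ {I′ D′} → Layout j ζ I′ D′ → I′ 10 ≡ i → I′ 12 ≡ failure w (suc i) →
          D′ (n + i) ≡ v → (∀ {k} → k ≢ scratch → k ≢ n + i → D′ k ≡ D k) →
          Ok t (iop add 10 10 3 ∷ scanLoop ++ K , ⟨ I′ , D′ ⟩) (suc rest)
        next-row L I′10 I′12 sum≡ same = Ok-iop t (Layout.safe L) (trans (cong₂ _+_ I′10 (Layout.I3 L)) (ℕ.+-comm i 1)) $
          Ok-scan r t (trans (ℕ.+-suc r i) r+i≡m)
            (advance i<m S (layout-≔ᵢ 0 (ℕ.≤-trans i<m m≤maxIndex) L) refl I′12 sum≡ same) exit

        same₁ : ∀ {k} → k ≢ scratch → D₁ k ≡ D k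
        same₁ k≢ = ≔-other D (k≢ ∘ sym)

        same₃ : ∀ {k} → k ≢ scratch → k ≢ n + i → D₃ k ≡ D k
        same₃ k≢ k≢′ = trans (≔-other D₂ (k≢′ ∘ sym)) (trans (≔-other D₁ (k≢ ∘ sym)) (same₁ k≢))

        product : D₁ (I 5) ℚ.* D₁ (I 8) ≡ a ℚ.* δ
        product = cong₂ ℚ._*_ loaded
          (trans (cong D₁ I8) (trans (same₁ (ℕ.<⇒≢ scratch<changeCell ∘ sym)) change≡))

        updated : D₂ (n + i) ℚ.+ D₂ (I 5) ≡ v
        updated = trans (cong₂ ℚ._+_
          (trans (≔-other D₁ (ℕ.<⇒≢ n+i<scratch ∘ sym)) (same₁ (ℕ.<⇒≢ n+i<scratch)))
          (trans (cong D₂ I5) (≔-same D₁ scratch))) (todo ℕ.≤-refl i<m)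

        unchanged : a ≡ 0ℚ → D₁ (n + i) ≡ v
        unchanged a≡0 = trans (same₁ (ℕ.<⇒≢ n+i<scratch)) $ trans (sym (ℚ.+-identityʳ (D (n + i)))) $
          trans (cong (D (n + i) ℚ.+_) (sym (trans (cong (ℚ._* δ) a≡0) (ℚ.*-zeroˡ δ)))) (todo ℕ.≤-refl i<m)

        update : ∀ {y} → a ≢ 0ℚ →
          Ok t (if (data≡ 13 6) (iconst 12 1 ∷ []) [] ∷ iop add 10 10 3 ∷ scanLoop ++ K , ⟨ I₃ , D₃ ⟩) y →
          Ok t (if (data≡ 5 6) [] addTerm ∷ iop add 10 10 3 ∷ scanLoop ++ K , ⟨ I , D₁ ⟩) (4 + y)
        update a≢0 ok =
          Ok-if-false t (Layout.safe L₁) (dec-false (D₁ (I 5) ℚ.≟ D₁ (I 6))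
            λ eq → a≢0 (trans (sym loaded) (trans eq (trans (cong D₁ I6) (Layout.zero≡ L₁))))) $
          Ok-dop t (Layout.safe L₁) I5 product $
          Ok-iop t (Layout.safe L₂) (cong₂ _+_ I0 I10) $
          Ok-dop t (Layout.safe L₂′) refl updated ok

        zero₃ : D₃ (I 6) ≡ 0ℚ
        zero₃ = trans (cong D₃ I6) (Layout.zero≡ L₃)

        body : Dec (a ≡ 0ℚ) → Dec (v ≡ 0ℚ) →
          Ok t (if (data≡ 5 6) [] addTerm ∷ iop add 10 10 3 ∷ scanLoop ++ K , ⟨ I , D₁ ⟩) (7 + rest)
        body (yes a≡0) _ = Ok-mono t (ℕ.m≤n+m (2 + rest) 5) $
          Ok-if-true t (Layout.safe L₁) (dec-true (D₁ (I 5) ℚ.≟ D₁ (I 6))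
            (trans loaded (trans a≡0 (sym (trans (cong D₁ I6) (Layout.zero≡ L₁)))))) $
          next-row L₁ I10
            (trans I12 (sym (flag-¬bad column (extended ζ j w) i λ bad → proj₁ bad a≡0)))
            (unchanged a≡0) (λ k≢ _ → same₁ k≢)
        body (no a≢0) (yes v≡0) = update a≢0 $
          Ok-if-true t (Layout.safe L₃) (dec-true (D₃ (n + i) ℚ.≟ D₃ (I 6))
            (trans (≔-same D₂ (n + i)) (trans v≡0 (sym zero₃)))) $
          Ok-iconst t (Layout.safe L₃) $
          next-row (layout-≔ᵢ 2 1≤maxIndex L₃) I10
            (sym (flag-bad column (extended ζ j w) i (a≢0 , v≡0))) (≔-same D₂ (n + i)) same₃
        body (no a≢0) (no v≢0) = update a≢0 $ Ok-mono t (ℕ.n≤1+n (2 + rest)) $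
          Ok-if-false t (Layout.safe L₃) (dec-false (D₃ (n + i) ℚ.≟ D₃ (I 6))
            λ eq → v≢0 (trans (sym (≔-same D₂ (n + i))) (trans eq zero₃))) $
          next-row L₃ I10
            (trans I12 (sym (flag-¬bad column (extended ζ j w) i λ bad → v≢0 (proj₂ bad))))
            (≔-same D₂ (n + i)) same₃

    -- The state between two attempts: whether or not `w` is acceptable, the stored sums agree with
    -- it, which is what lets a retry correct them by a difference.
    record Tried (w : ℤ) (I : ℕ → ℕ) (D : ℕ → ℚ) : Set where
      field
        layout : Layout j ζ I D
        w≤m    : ℤ.∣ w ∣ ≤ m
        w≡     : D j ≡ fromℤ w
        sums   : ∀ {k} → k < m → D (n + k) ≡ extended ζ j w k
      open Layout layout public

    Ok-attempt : ∀ t {K x I D w} (u : Fin (suc (m + m))) → Tried w I D →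
      (∀ {I D} → Tried (centred m u) I D → I 12 ≡ failure (centred m u) m → Ok t (K , ⟨ I , D ⟩) x) →
      Ok t (attempt ++ K , ⟨ I [ 11 ≔ toℕ u ] , D ⟩) (6 + (m * 9 + suc x))
    Ok-attempt t {K} {x} {I} {D} {w} u tried exit =
      Ok-dop t (Layout.safe L₀) I8 negated $
      Ok-cast t (Layout.safe L₁) I9 refl $
      Ok-dop t (Layout.safe L₂) I9 shifted $
      Ok-dop t (Layout.safe L₃) I8 difference $
      Ok-iconst t (Layout.safe L₄) $
      Ok-iconst t (Layout.safe L₅) $
      Ok-scan m t (ℕ.+-identityʳ m) scanned λ S → exit (record
        { layout = Scanned.layout S ; w≤m = ∣centred∣≤m m u ; w≡ = Scanned.w≡ S ; sums = Scanned.done S })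
        (Scanned.I12 S)
      where
      open Tried tried
      w′ δ : ℤ
      w′ = centred m u
      δ  = w′ ℤ.- w
      u≤2m : toℕ u ≤ m + m
      u≤2m = ℕ.≤-pred (Fin.toℕ<n u)
      w′≤2m : ℤ.∣ w′ ∣ ≤ m + m
      w′≤2m = ℕ.m≤n⇒m≤n+o m (∣centred∣≤m m u)
      -w≤2m : ℤ.∣ + 0 ℤ.- w ∣ ≤ m + m
      -w≤2m = ℕ.≤-trans (ℤ.∣i-j∣≤∣i∣+∣j∣ (+ 0) w) (ℕ.m≤n⇒m≤n+o m w≤m)
      δ≤2m : ℤ.∣ δ ∣ ≤ m + m
      δ≤2m = ℕ.≤-trans (ℤ.∣i-j∣≤∣i∣+∣j∣ w′ w) (ℕ.+-mono-≤ (∣centred∣≤m m u) w≤m)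

      open Scan w′ (∣centred∣≤m m u) (fromℤ δ) (height-fromℤ≤ δ δ≤2m)

      D₁ D₂ D₃ D₄ : ℕ → ℚ
      D₁ = D [ changeCell ≔ fromℤ (+ 0 ℤ.- w) ]
      D₂ = D₁ [ j ≔ fromℕ (toℕ u) ]
      D₃ = D₂ [ j ≔ fromℤ w′ ]
      D₄ = D₃ [ changeCell ≔ fromℤ δ ]

      writable-j : Writable j j
      writable-j = writable-≤scratch ℕ.≤-refl (ℕ.<⇒≤ j<scratch)

      L₀ : Layout j ζ (I [ 11 ≔ toℕ u ]) D
      L₀ = layout-≔ᵢ 1 (ℕ.≤-trans u≤2m 2m≤maxIndex) layout
      L₁ : Layout j ζ (I [ 11 ≔ toℕ u ]) D₁
      L₁ = layout-≔ (writable-changeCell j<n) (height-fromℤ≤max (+ 0 ℤ.- w) -w≤2m) L₀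
      L₂ : Layout j ζ (I [ 11 ≔ toℕ u ]) D₂
      L₂ = layout-≔ writable-j (height-fromℤ≤max (+ toℕ u) u≤2m) L₁
      L₃ : Layout j ζ (I [ 11 ≔ toℕ u ]) D₃
      L₃ = layout-≔ writable-j (height-fromℤ≤max w′ w′≤2m) L₂
      L₄ : Layout j ζ (I [ 11 ≔ toℕ u ]) D₄
      L₄ = layout-≔ (writable-changeCell j<n) (height-fromℤ≤max δ δ≤2m) L₃
      L₅ : Layout j ζ (I [ 11 ≔ toℕ u ] [ 12 ≔ 0 ]) D₄
      L₅ = layout-≔ᵢ 2 z≤n L₄

      negated : D (I 6) ℚ.- D (I 9) ≡ fromℤ (+ 0 ℤ.- w)
      negated = trans (cong₂ ℚ._-_ (trans (cong D I6) zero≡) (trans (cong D I9) w≡)) (sym (fromℤ-- (+ 0) w))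

      shifted : D₂ (I 9) ℚ.- D₂ (I 7) ≡ fromℤ w′
      shifted = trans (cong₂ ℚ._-_ (trans (cong D₂ I9) (≔-same D₁ j)) (trans (cong D₂ I7) (Layout.m≡ L₂)))
        (sym (fromℤ-- (+ toℕ u) (+ m)))

      j≢changeCell : j ≢ changeCell
      j≢changeCell = ℕ.<⇒≢ (ℕ.<-trans j<scratch scratch<changeCell)

      difference : D₃ (I 8) ℚ.+ D₃ (I 9) ≡ fromℤ δ
      difference = begin
        D₃ (I 8) ℚ.+ D₃ (I 9)                 ≡⟨ cong₂ ℚ._+_ D₃I8 (trans (cong D₃ I9) (≔-same D₂ j)) ⟩
        fromℤ (+ 0 ℤ.- w) ℚ.+ fromℤ w′        ≡⟨ fromℤ-+ (+ 0 ℤ.- w) w′ ⟨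
        fromℤ (+ 0 ℤ.- w ℤ.+ w′)              ≡⟨ cong (λ k → fromℤ (k ℤ.+ w′)) (ℤ.+-identityˡ (ℤ.- w)) ⟩
        fromℤ (ℤ.- w ℤ.+ w′)                  ≡⟨ cong fromℤ (ℤ.+-comm (ℤ.- w) w′) ⟩
        fromℤ δ ∎
        where
        open ≡-Reasoning
        D₃I8 : D₃ (I 8) ≡ fromℤ (+ 0 ℤ.- w)
        D₃I8 = trans (cong D₃ I8) $ trans (≔-other D₂ j≢changeCell) $
          trans (≔-other D₁ j≢changeCell) (≔-same D changeCell)

      same : ∀ {k} → k < m → D₄ (n + k) ≡ D (n + k)
      same {k} k<m = trans (≔-other D₃ c≢) (trans (≔-other D₂ j≢) (trans (≔-other D₁ j≢) (≔-other D c≢)))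
        where
        c≢ : changeCell ≢ n + k
        c≢ = ℕ.<⇒≢ (ℕ.<-trans (sum<scratch k<m) scratch<changeCell) ∘ sym
        j≢ : j ≢ n + k
        j≢ = ℕ.<⇒≢ (ℕ.<-≤-trans j<n (ℕ.m≤m+n n k))

      moved : ∀ {k} → k < m → D₄ (n + k) ℚ.+ column k ℚ.* fromℤ δ ≡ extended ζ j w′ k
      moved {k} k<m = begin
        D₄ (n + k) ℚ.+ a ℚ.* fromℤ δ                   ≡⟨ cong (ℚ._+ a ℚ.* fromℤ δ) (trans (same k<m) (sums k<m)) ⟩
        p ℚ.+ a ℚ.* fromℤ w ℚ.+ a ℚ.* fromℤ δ          ≡⟨ ℚ.+-assoc p (a ℚ.* fromℤ w) (a ℚ.* fromℤ δ) ⟩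
        p ℚ.+ (a ℚ.* fromℤ w ℚ.+ a ℚ.* fromℤ δ)        ≡⟨ cong (p ℚ.+_) (ℚ.*-distribˡ-+ a (fromℤ w) (fromℤ δ)) ⟨
        p ℚ.+ a ℚ.* (fromℤ w ℚ.+ fromℤ δ)              ≡⟨ cong (λ q → p ℚ.+ a ℚ.* q) (fromℤ-+ w δ) ⟨
        p ℚ.+ a ℚ.* fromℤ (w ℤ.+ δ)                    ≡⟨ cong (λ k → p ℚ.+ a ℚ.* fromℤ k) (w+δ≡w′ w w′) ⟩
        extended ζ j w′ k ∎
        where
        open ≡-Reasoning
        a = column k
        p = partial ζ j k
        w+δ≡w′ : ∀ w w′ → w ℤ.+ (w′ ℤ.- w) ≡ w′
        w+δ≡w′ = solveℤ-∀

      scanned : Scanned 0 (I [ 11 ≔ toℕ u ] [ 12 ≔ 0 ] [ 10 ≔ 0 ]) D₄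
      scanned = record
        { layout = layout-≔ᵢ 0 z≤n L₅ ; I10 = refl ; I12 = refl
        ; change≡ = ≔-same D₃ changeCell
        ; w≡ = trans (≔-other D₃ (j≢changeCell ∘ sym)) (≔-same D₂ j)
        ; done = λ () ; todo = λ _ → moved }

    NoBad : ℤ → Set
    NoBad w = ∀ {k} → k < m → ¬ Bad (column k) (extended ζ j w k)

    sum-failure≤m : sum (λ u → failure (centred m u) m) ≤ m
    sum-failure≤m = sum-flag≤ column (λ u → extended ζ j (centred m u)) m
      λ {l} _ {u} {u′} (a≢0 , root) (_ , root′) → centred-injective m
        (fromℤ-injective (affine-root-unique (partial ζ j l) a≢0 root root′))

    -- The bound reproduces itself: a further `retryCost`, about twice the cost of an attempt, is
    -- incurred with probability at most `m / (2m + 1)`, which is below 1/2.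
    expected-cost : ∀ x →
      suc (m + m) + sum (λ u → (attemptCost + suc x) + failure (centred m u) m * retryCost) ≤
      suc (m + m) * (2 * (attemptCost + 2) + suc x)
    expected-cost x = begin
      k + sum (λ u → b + failure (centred m u) m * retryCost)
        ≡⟨ cong (k ℕ.+_) (sum-affine b retryCost (λ u → failure (centred m u) m)) ⟩
      k + (k * b + sum (λ u → failure (centred m u) m) * retryCost)
        ≤⟨ ℕ.+-monoʳ-≤ k (ℕ.+-monoʳ-≤ (k * b) (ℕ.*-monoˡ-≤ retryCost sum-failure≤m)) ⟩
      k + (k * b + m * retryCost)
        -- The exact difference of the two sides, which leaves a polynomial identity.
        ≤⟨ ℕ.m≤m+n _ (attemptCost + 3 + m) ⟩
      k + (k * b + m * retryCost) + (attemptCost + 3 + m)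
        ≡⟨ rearrange m attemptCost (suc x) ⟩
      k * (2 * (attemptCost + 2) + suc x) ∎
      where
      open ℕ.≤-Reasoning
      k = suc (m + m)
      b = attemptCost + suc x
      rearrange : ∀ m c x →
        suc (m + m) + (suc (m + m) * (c + x) + m * suc (2 * (c + 2))) + (c + 3 + m) ≡
        suc (m + m) * (2 * (c + 2) + x)
      rearrange = solve-∀

    -- With no bound on the number of attempts, the induction is on the step index: each pass
    -- through the loop consumes at least one unit, and `Ok-pred` lowers the continuation
    -- accordingly.
    Ok-retry : ∀ t {K x I D w} → Tried w I D → I 12 ≡ 1 →
      (∀ {I D w} → Tried w I D → NoBad w → Ok t (K , ⟨ I , D ⟩) x) →
      Ok t (retryLoop ++ K , ⟨ I , D ⟩) (retryCost + suc x)
    Ok-retry zero    tried I12 exit = tt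
    Ok-retry (suc t) {K} {x} {I} {D} {w} tried I12 exit =
      Ok-while-true⁺ t {K} safe {index< 2 12} {uniform 11 4 ∷ attempt} (dec-true (I 2 ℕ.<? I 12) (subst₂ _<_ (sym I2) (sym I12) (s≤s z≤n))) $
      Ok-uniform t safe {r = 11} {u = 4} I4 (λ u → (attemptCost + suc x) + failure (centred m u) m * retryCost)
        (λ u → Ok-mono t (ℕ.≤-reflexive (rearrange (m * 9) x (failure (centred m u) m * retryCost))) $
          Ok-attempt t u tried (again (centred m u)))
        (expected-cost x)
      where
      open Tried tried
      rearrange : ∀ a x f → 6 + (a + suc (suc x + f)) ≡ (7 + a + suc x) + f
      rearrange = solve-∀
      again : ∀ w′ {I′ D′} → Tried w′ I′ D′ → I′ 12 ≡ failure w′ m →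
        Ok t (retryLoop ++ K , ⟨ I′ , D′ ⟩) (suc x + failure w′ m * retryCost)
      again w′ {I′} tried′ I′12 with flag-0⊎1 column (extended ζ j w′) m
      ... | inj₁ f≡0 = Ok-mono t (ℕ.m≤m+n (suc x) _) $
        Ok-while-false t (Tried.safe tried′)
          (dec-false (I′ 2 ℕ.<? I′ 12) λ lt → ℕ.n≮0 (subst (I′ 2 <_) (trans I′12 f≡0) lt))
          (Ok-pred t (exit tried′ (flag≡0⇒¬bad column (extended ζ j w′) m f≡0)))
      ... | inj₂ f≡1 = Ok-mono t (ℕ.≤-reflexive cost≡) $
        Ok-retry t tried′ (trans I′12 f≡1) (λ tried″ noBad → Ok-pred t (exit tried″ noBad))
        where
        cost≡ : retryCost + suc x ≡ suc x + failure w′ m * retryCost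
        cost≡ = trans (ℕ.+-comm retryCost (suc x))
          (cong (suc x ℕ.+_) (sym (trans (cong (_* retryCost) f≡1) (ℕ.*-identityˡ retryCost))))

  -- Choosing all coordinates.

  record Chosen (j : ℕ) (ζ : ℕ → ℤ) (I : ℕ → ℕ) (D : ℕ → ℚ) : Set where
    field
      layout : Layout j ζ I D
      -- All values are bounded, not only those below `j`, as `ζ` starts out as the zero function.
      ζ≤m    : ∀ l → ℤ.∣ ζ l ∣ ≤ m
      sums   : ∀ {i} → i < m → D (n + i) ≡ partial ζ j i
      apart  : ∀ {i} → i < m → (∀ {l} → l < j → entry A i l ≡ 0ℚ) ⊎ partial ζ j i ≢ 0ℚ
    open Layout layout public

  -- Besides `retryCost`, a column takes 5 steps: the loop test, two initialisations, the last test
  -- of the retry loop and the increment.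
  Ok-columns : ∀ r t {K x j ζ I D} → r + j ≡ n → Chosen j ζ I D →
    (∀ {ζ I D} → Chosen n ζ I D → Ok t (K , ⟨ I , D ⟩) x) →
    Ok t (columnLoop ++ K , ⟨ I , D ⟩) (r * (5 + retryCost) + suc x)
  Ok-columns zero t {I = I} refl C exit =
    Ok-while-false t safe (dec-false (I 9 ℕ.<? I 0) (ℕ.<-irrefl (trans I9 (sym I0)))) (exit C)
    where open Chosen C
  Ok-columns (suc r) t {K} {x} {j} {ζ} {I} {D} r+j≡n C exit =
    Ok-mono t (ℕ.≤-reflexive (rearrange retryCost (r * (5 + retryCost)) (suc x))) $
    Ok-while-true t safe (dec-true (I 9 ℕ.<? I 0) (subst₂ _<_ (sym I9) (sym I0) j<n)) $
    Ok-dconst t safe I9 $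
    Ok-iconst t (Layout.safe L₁) $
    Ok-retry t tried refl λ tried′ noBad →
    Ok-iop t (Tried.safe tried′) (trans (cong₂ _+_ (Tried.I9 tried′) (Tried.I3 tried′)) (ℕ.+-comm j 1)) $
    Ok-columns r t (trans (ℕ.+-suc r j) r+j≡n) (chosen tried′ noBad) exit
    where
    open Chosen C
    rearrange : ∀ c y z → 3 + (c + suc (suc (y + z))) ≡ 5 + c + y + z
    rearrange = solve-∀
    j<n : j < n
    j<n = ℕ.m+n≤o⇒n≤o r (ℕ.≤-reflexive (trans (ℕ.+-suc r j) r+j≡n))

    open Column j<n ζ ζ≤m

    L₁ : Layout j ζ I (D [ j ≔ 0ℚ ])
    L₁ = layout-≔ (writable-≤scratch ℕ.≤-refl (ℕ.<⇒≤ j<scratch)) (height-fromℤ≤max (+ 0) z≤n) layout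

    tried : Tried (+ 0) (I [ 12 ≔ 1 ]) (D [ j ≔ 0ℚ ])
    tried = record
      { layout = layout-≔ᵢ 2 1≤maxIndex L₁ ; w≤m = z≤n ; w≡ = ≔-same D j
      ; sums = λ {k} k<m → trans (≔-other D (ℕ.<⇒≢ (ℕ.<-≤-trans j<n (ℕ.m≤m+n n k)))) $
          trans (sums k<m) (sym (trans (cong (partial ζ j k ℚ.+_) (ℚ.*-zeroʳ (column k)))
            (ℚ.+-identityʳ (partial ζ j k)))) }

    chosen : ∀ {w I′ D′} → Tried w I′ D′ → NoBad w → Chosen (suc j) (ζ [ j ≔ w ]) (I′ [ 9 ≔ suc j ]) D′
    chosen {w} {I′} {D′} tried′ noBad = record
      { layout = record
        { frame = frame-≔ 0 T.frame ; I9 = refl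
        ; safe = safe-≔ᵢ 9 {D = D′} (ℕ.≤-trans j<n n≤maxIndex) T.safe
        ; zero≡ = T.zero≡ ; m≡ = T.m≡ ; ζ≡ = ζ′≡ }
      ; ζ≤m = ≔-all ζ j w (λ k → ℤ.∣ k ∣ ≤ m) ζ≤m T.w≤m
      ; sums = λ {i} i<m → trans (T.sums i<m) (sym (partial-≔ ζ j w i))
      ; apart = λ i<m → apart′ i<m (apart i<m) (¬bad⇒ (noBad i<m)) }
      where
      module T = Tried tried′
      ζ′≡ : ∀ {l} → l < suc j → D′ l ≡ fromℤ ((ζ [ j ≔ w ]) l)
      ζ′≡ l<1+j with ℕ.m<1+n⇒m<n∨m≡n l<1+j
      ... | inj₂ refl = trans T.w≡ (cong fromℤ (sym (≔-same ζ j)))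
      ... | inj₁ l<j  = trans (T.ζ≡ l<j) (cong fromℤ (sym (≔-other ζ (ℕ.<⇒≢ l<j ∘ sym))))
      apart′ : ∀ {i} → i < m → (∀ {l} → l < j → entry A i l ≡ 0ℚ) ⊎ partial ζ j i ≢ 0ℚ →
        entry A i j ≡ 0ℚ ⊎ extended ζ j w i ≢ 0ℚ →
        (∀ {l} → l < suc j → entry A i l ≡ 0ℚ) ⊎ partial (ζ [ j ≔ w ]) (suc j) i ≢ 0ℚ
      apart′ {i} i<m _ (inj₂ v≢0) = inj₂ (v≢0 ∘ trans (sym (partial-≔ ζ j w i)))
      apart′ {i} i<m (inj₁ zeros) (inj₁ a≡0) = inj₁ zeros′
        where
        zeros′ : ∀ {l} → l < suc j → entry A i l ≡ 0ℚ
        zeros′ l<1+j with ℕ.m<1+n⇒m<n∨m≡n l<1+j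
        ... | inj₂ refl = a≡0
        ... | inj₁ l<j  = zeros l<j
      apart′ {i} i<m (inj₂ p≢0) (inj₁ a≡0) = inj₂ (p≢0 ∘ trans (sym extended≡))
        where
        extended≡ : partial (ζ [ j ≔ w ]) (suc j) i ≡ partial ζ j i
        extended≡ = trans (partial-≔ ζ j w i) $
          trans (cong (λ a → partial ζ j i ℚ.+ a ℚ.* fromℤ w) a≡0) $
          trans (cong (partial ζ j i ℚ.+_) (ℚ.*-zeroˡ (fromℤ w))) (ℚ.+-identityʳ (partial ζ j i))

  -- Correctness of the output.

  ᵀ≡partial : ∀ ζ i → lookup A i ᵀ Vec.tabulate (ζ ∘ toℕ) ≡ partial ζ n (toℕ i)
  ᵀ≡partial ζ i = sym (Σℚ-foldr _ (Vec.zipWith _*′_ (lookup A i) z) λ l → begin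
    entry A (toℕ i) (toℕ l) *′ ζ (toℕ l)       ≡⟨ cong₂ _*′_ (entry-lookup A i l) (sym (Vec.lookup∘tabulate (ζ ∘ toℕ) l)) ⟩
    lookup (lookup A i) l *′ lookup z l        ≡⟨ Vec.lookup-zipWith _*′_ l (lookup A i) z ⟨
    lookup (Vec.zipWith _*′_ (lookup A i) z) l ∎)
    where
    open ≡-Reasoning
    _*′_ : ℚ → ℤ → ℚ
    x *′ k = x ℚ.* fromℤ k
    z = Vec.tabulate (ζ ∘ toℕ)

  ∈⇒lookup : ∀ {a} → a ∈ A → Σ[ i ∈ Fin m ] a ≡ lookup A i
  ∈⇒lookup a∈A = Any.index a∈A , Any.lookup-index a∈A

  chosen⇒final : (∀ a → a ∈ A → NonZeroVec a) → ∀ {ζ I D} → Chosen n ζ I D → Final ⟨ I , D ⟩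
  chosen⇒final nonZero {ζ} C = z ,
    (λ i → trans (ζ≡ (Fin.toℕ<n i)) (cong fromℤ (sym (z≡ i)))) , nonOrthogonal ,
    ‖‖∞≤ z (λ i → subst (λ k → ℤ.∣ k ∣ ≤ m) (sym (z≡ i)) (ζ≤m (toℕ i)))
    where
    open Chosen C
    z : Vec ℤ n
    z = Vec.tabulate (ζ ∘ toℕ)
    z≡ : ∀ i → lookup z i ≡ ζ (toℕ i)
    z≡ = Vec.lookup∘tabulate (ζ ∘ toℕ)
    nonOrthogonal : ∀ a → a ∈ A → a ᵀ z ≢ 0ℚ
    nonOrthogonal a a∈A with ∈⇒lookup a∈A
    ... | i , refl with apart (Fin.toℕ<n i)
    ...   | inj₂ p≢0  = p≢0 ∘ trans (sym (ᵀ≡partial ζ i))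
    -- After all `n` columns, this alternative of the invariant says that the row is the zero
    -- vector.
    ...   | inj₁ zeros = contradiction
      (lookup≡0⇒≡replicate _ λ l → trans (sym (entry-lookup A i l)) (zeros (Fin.toℕ<n l)))
      (nonZero a a∈A)

  -- The running time of the whole program.

  Ok-halt : ∀ t {s} → Safe s → Final s → Ok t ([] , s) 0
  Ok-halt zero    safe final = tt
  Ok-halt (suc t) safe final = safe , final

  -- The maximum with 1 accounts for the constant cost that remains when `n * m` is 0.
  budget : ℕ
  budget = 51 * ((n * m) ⊔ 1)

  -- A column costs `24 + 18 * m`, hence at most `42 * m` for positive `m`; the 9 steps outside the
  -- columns give `51 = 9 + 42`.
  setup-cost : 0 < m → 8 + (n * (5 + retryCost) + 1) ≤ budget
  setup-cost 0<m = begin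
    8 + (n * (5 + retryCost) + 1)                    ≡⟨ expand n m ⟩
    9 * 1 + (n * (24 * 1) + 18 * (n * m))            ≤⟨ ℕ.+-monoʳ-≤ 9 (ℕ.+-monoˡ-≤ (18 * (n * m)) (ℕ.*-monoʳ-≤ n (ℕ.*-monoʳ-≤ 24 0<m))) ⟩
    9 * 1 + (n * (24 * m) + 18 * (n * m))            ≡⟨ cong (9 ℕ.+_) (collect n m) ⟩
    9 * 1 + 42 * (n * m)                             ≤⟨ ℕ.+-mono-≤ (ℕ.*-monoʳ-≤ 9 (ℕ.m≤n⊔m (n * m) 1)) (ℕ.*-monoʳ-≤ 42 (ℕ.m≤m⊔n (n * m) 1)) ⟩
    9 * ((n * m) ⊔ 1) + 42 * ((n * m) ⊔ 1)           ≡⟨ ℕ.*-distribʳ-+ ((n * m) ⊔ 1) 9 42 ⟨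
    budget ∎
    where
    open ℕ.≤-Reasoning
    expand : ∀ n m → 8 + (n * (5 + suc (2 * (7 + m * 9 + 2))) + 1) ≡ 9 * 1 + (n * (24 * 1) + 18 * (n * m))
    expand = solve-∀
    collect : ∀ n m → n * (24 * m) + 18 * (n * m) ≡ 42 * (n * m)
    collect = solve-∀

  Ok-program : (∀ a → a ∈ A → NonZeroVec a) → ∀ t → Ok t (initial program A) budget
  Ok-program nonZero t = run (0 ℕ.<? m)
    where
    D₀ D₁ : ℕ → ℚ
    D₀ _ = 0ℚ
    D₁ = D₀ [ mCell ≔ fromℕ m ]
    I₀ I₁ I₂ I₃ I₄ I₅ I₆ : ℕ → ℕ
    I₀ = (λ _ → 0) [ 0 ≔ n ] [ 1 ≔ m ]
    I₁ = I₀ [ 3 ≔ 1 ]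
    I₂ = I₁ [ 4 ≔ m + m ]
    I₃ = I₂ [ 5 ≔ scratch ]
    I₄ = I₃ [ 6 ≔ zeroCell ]
    I₅ = I₄ [ 7 ≔ mCell ]
    I₆ = I₅ [ 8 ≔ changeCell ]

    safe₀ : Safe ⟨ I₀ , D₀ ⟩
    safe₀ = safe-≔ᵢ 1 {D = D₀} m≤maxIndex
      (safe-≔ᵢ 0 {D = D₀} n≤maxIndex ((λ _ → z≤n) , λ _ → ℕ.m^n>0 2 maxLog))
    safe₁ : Safe ⟨ I₁ , D₀ ⟩
    safe₁ = safe-≔ᵢ 3 {D = D₀} 1≤maxIndex safe₀
    safe₂ : Safe ⟨ I₂ , D₀ ⟩
    safe₂ = safe-≔ᵢ 4 {D = D₀} 2m≤maxIndex safe₁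
    safe₃ : Safe ⟨ I₃ , D₀ ⟩
    safe₃ = safe-≔ᵢ 5 {D = D₀} scratch≤maxIndex safe₂
    safe₄ : Safe ⟨ I₄ , D₀ ⟩
    safe₄ = safe-≔ᵢ 6 {D = D₀} (ℕ.m≤n⇒m≤n+o m (ℕ.<⇒≤ (ℕ.<-trans (k<k+1 zeroCell) (k<k+1 mCell)))) safe₃
    safe₅ : Safe ⟨ I₅ , D₀ ⟩
    safe₅ = safe-≔ᵢ 7 {D = D₀} (ℕ.m≤n⇒m≤n+o m (ℕ.<⇒≤ (k<k+1 mCell))) safe₄
    safe₆ : Safe ⟨ I₆ , D₀ ⟩
    safe₆ = safe-≔ᵢ 8 {D = D₀} (ℕ.m≤m+n changeCell m) safe₅
    safe₇ : Safe ⟨ I₆ , D₁ ⟩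
    safe₇ = safe-≔ mCell {I = I₆} (height-fromℤ≤max (+ m) (ℕ.m≤m+n m m)) safe₆

    start : Chosen 0 (λ _ → + 0) I₆ D₁
    start = record
      { layout = record
        { frame = record
          { I0 = refl ; I1 = refl ; I2 = refl ; I3 = refl ; I4 = refl
          ; I5 = refl ; I6 = refl ; I7 = refl ; I8 = refl }
        ; I9 = refl ; safe = safe₇
        ; zero≡ = ≔-other D₀ (ℕ.<⇒≢ (k<k+1 zeroCell) ∘ sym)
        ; m≡ = ≔-same D₀ mCell ; ζ≡ = λ () }
      ; ζ≤m = λ _ → z≤n
      ; sums = λ i<m → ≔-other D₀ (ℕ.<⇒≢ (ℕ.<-trans (sum<scratch i<m) scratch<mCell) ∘ sym)
      ; apart = λ _ → inj₁ λ () }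

    zeroFinal : ¬ 0 < m → Final ⟨ I₁ , D₀ ⟩
    zeroFinal m≯0 = replicate n (+ 0) ,
      (λ i → cong fromℤ (sym (Vec.lookup-replicate i (+ 0)))) ,
      (λ a a∈A → contradiction (ℕ.≤-<-trans z≤n (Fin.toℕ<n (Any.index a∈A))) m≯0) ,
      ‖‖∞≤ (replicate n (+ 0)) λ i → subst (λ k → ℤ.∣ k ∣ ≤ m) (sym (Vec.lookup-replicate i (+ 0))) z≤n

    run : Dec (0 < m) → Ok t (initial program A) budget
    run (no m≯0) = Ok-mono t (ℕ.*-mono-≤ {2} {51} (s≤s (s≤s z≤n)) (ℕ.m≤n⊔m (n * m) 1)) $
      Ok-iconst t safe₀ $
      Ok-if-false t safe₁ (dec-false (0 ℕ.<? m) m≯0) $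
      Ok-halt t safe₁ (zeroFinal m≯0)
    run (yes 0<m) = Ok-mono t (setup-cost 0<m) $
      Ok-iconst t safe₀ $
      Ok-if-true t safe₁ (dec-true (0 ℕ.<? m) 0<m) $
      Ok-iop t safe₁ refl $
      Ok-iop t safe₂ refl $
      Ok-iop t safe₃ refl $
      Ok-iop t safe₄ refl $
      Ok-iop t safe₅ refl $
      Ok-cast t safe₆ refl refl $
      Ok-columns n t (ℕ.+-identityʳ n) start λ C → Ok-halt t (Chosen.safe C) (chosen⇒final nonZero C)

  -- Polynomial bit-sizes and the theorem.

  1≤inputSize : 1 ≤ inputSize A
  1≤inputSize = ℕ.≤-trans (s≤s z≤n) sizeℕm≤inputSize

  maxIndex<2^ : suc maxIndex ≤ 2 ^ (2 + inputSize A)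
  maxIndex<2^ = begin
    suc maxIndex                                     ≡⟨ rearrange n m ⟩
    suc n + 2 * suc m + 1                            ≤⟨ ℕ.+-mono-≤ (ℕ.+-mono-≤ (index≤ sizeℕn≤inputSize) (≤2^S sizeℕm≤inputSize)) (ℕ.m^n>0 2 S) ⟩
    -- A fourth copy rounds the sum up to a power of 2.
    2 ^ S + 2 ^ S + 2 ^ S                            ≤⟨ ℕ.m≤m+n _ (2 ^ S) ⟩
    2 ^ S + 2 ^ S + 2 ^ S + 2 ^ S                    ≡⟨ double (2 ^ S) ⟩
    2 ^ (2 + S) ∎
    where
    open ℕ.≤-Reasoning
    S = inputSize A
    rearrange : ∀ n m → suc (n + m + 1 + 1 + 1 + m) ≡ suc n + 2 * suc m + 1
    rearrange = solve-∀
    double : ∀ p → p + p + p + p ≡ 2 * (2 * p)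
    double = solve-∀
    ≤2^S : ∀ {k} → sizeℕ k ≤ S → 2 * suc k ≤ 2 ^ S
    ≤2^S {k} k≤S = ℕ.≤-trans (2*suc≤2^sizeℕ k) (ℕ.^-monoʳ-≤ 2 k≤S)
    index≤ : ∀ {k} → sizeℕ k ≤ S → suc k ≤ 2 ^ S
    index≤ {k} k≤S = ℕ.≤-trans (ℕ.m≤m+n (suc k) _) (≤2^S k≤S)

  -- The constant 6 comes from the data cells, of size at most `2 + 2 * S + 2 * (S * S)` with
  -- `S ≥ 1`; index registers stay within `3 + S`.
  safe⇒sizes≤ : ∀ {s} → Safe s →
    ∀ k → sizeℕ (I s k) ≤ 6 * inputSize A ^ 2 × sizeℚ (D s k) ≤ 6 * inputSize A ^ 2
  safe⇒sizes≤ {s} (I≤ , D≤) k = indexSize , dataSize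
    where
    open ℕ.≤-Reasoning
    S = inputSize A
    instance
      S≢0 : ℕ.NonZero S
      S≢0 = ℕ.>-nonZero 1≤inputSize
    1≤S² : 1 ≤ S * S
    1≤S² = ℕ.*-mono-≤ 1≤inputSize 1≤inputSize
    indexSize : sizeℕ (I s k) ≤ 6 * S ^ 2
    indexSize = begin
      sizeℕ (I s k)                     ≤⟨ sizeℕ≤ {I s k} {2 + S} (ℕ.≤-trans (s≤s (I≤ k)) maxIndex<2^) ⟩
      3 * 1 + S                         ≤⟨ ℕ.+-mono-≤ (ℕ.*-monoʳ-≤ 3 1≤S²) (ℕ.m≤m*n S S) ⟩
      3 * (S * S) + S * S               ≤⟨ ℕ.m≤m+n _ (2 * (S * S)) ⟩
      3 * (S * S) + S * S + 2 * (S * S) ≡⟨ collect S ⟩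
      6 * S ^ 2 ∎
      where
      collect : ∀ S → 3 * (S * S) + S * S + 2 * (S * S) ≡ 6 * (S * (S * 1))
      collect = solve-∀
    dataSize : sizeℚ (D s k) ≤ 6 * S ^ 2
    dataSize = begin
      sizeℚ (D s k)                     ≤⟨ sizeℚ≤ (D s k) maxLog (D≤ k) ⟩
      2 + (maxLog + maxLog)             ≡⟨ rearrange S ⟩
      2 * 1 + (2 * S + 2 * (S * S))     ≤⟨ ℕ.+-mono-≤ (ℕ.*-monoʳ-≤ 2 1≤S²) (ℕ.+-monoˡ-≤ (2 * (S * S)) (ℕ.*-monoʳ-≤ 2 (ℕ.m≤m*n S S))) ⟩
      2 * (S * S) + (2 * (S * S) + 2 * (S * S)) ≡⟨ collect S ⟩
      6 * S ^ 2 ∎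
      where
      rearrange : ∀ S → 2 + ((S + S * S) + (S + S * S)) ≡ 2 * 1 + (2 * S + 2 * (S * S))
      rearrange = solve-∀
      collect : ∀ S → 2 * (S * S) + (2 * (S * S) + 2 * (S * S)) ≡ 6 * (S * (S * 1))
      collect = solve-∀

  module _ (nonZero : ∀ a → a ∈ A → NonZeroVec a) where

    -- Index 1 suffices to read off both safety of the current state and, if the program has halted,
    -- correctness of its output.
    program-ok : ∀ {c} → Reachable program A c → ∃[ x ] Ok 1 c x
    program-ok steps = Ok-reachable (λ t → budget , Ok-program nonZero t) steps 1

    program-correct : ∀ s → HaltsIn program A s → Final s
    program-correct s halts = let _ , _ , final = program-ok halts in final

    program-expectedSteps : ExpectedSteps≤ program A budget
    program-expectedSteps t = Ok⇒expectedSteps≤ t (initial program A) (Ok-program nonZero t)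

    program-bitSizes : BitSizes≤ program A (6 * inputSize A ^ 2)
    program-bitSizes {s = s} steps = let _ , safe , _ = program-ok steps in safe⇒sizes≤ {s} safe

theorem2 : Σ[ P ∈ Program ] Σ[ C ∈ ℕ ] Σ[ c ∈ ℕ ] Σ[ d ∈ ℕ ]
    ((n m : ℕ) (A : Vec (Vec ℚ n) m) → Unique A → (∀ a → a ∈ A → NonZeroVec a) →
    (∀ s → HaltsIn P A s →
    Σ[ z ∈ Vec ℤ n ] (Outputs s z × (∀ a → a ∈ A → a ᵀ z ≢ 0ℚ) × ‖ z ‖∞ ≤ m))
    × ExpectedSteps≤ P A (C * ((n * m) ⊔ 1))
    × BitSizes≤ P A (c * inputSize A ^ d))
theorem2 = program , 51 , 6 , 2 , λ n m A _ nonZero →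
  program-correct A nonZero , program-expectedSteps A nonZero , program-bitSizes A nonZero
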